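{- Let $F\in\mathbb{Z}[x_1,\dots,x_n]$ be an integral form in $n$ variables of degree greater than one. Suppose that there exist integers $a_1,\dots,a_{n-1}$ for which the one-variable polynomial $F(x,a_1,\dots,a_{n-1})\in\mathbb{Z}[x]$ has non-zero discriminant. Then $R(F)$ is dense in $\mathbb{Q}_p$ for infinitely many primes $p$.
   Context: A form is a homogeneous polynomial; it is integral if its coefficients lie in $\mathbb{Z}$. For an integral form $F$ in $r$ variables, its ratio set is $R(F)=\{F(\overline{x})/F(\overline{y}) : \overline{x},\overline{y}\in\mathbb{Z}^r,\ F(\overline{y})\neq 0\}\subseteq\mathbb{Q}$, and density refers to the $p$-adic topology on $\mathbb{Q}_p$. The discriminant of $f(x)=a_mx^m+\dots+a_0$ is $a_m^{2m-2}\prod_{i<j}(r_i-r_j)^2$, where $r_1,\dots,r_m$ are the roots of $f$ in an algebraic closure. -}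

module Defs where

open import Level using (Level; 0ℓ; _⊔_) renaming (suc to lsuc)
open import Algebra.Bundles using (CommutativeRing)
open import Algebra.Bundles.Raw using (RawRing)
open import Algebra.Apartness.Bundles using (HeytingField; HeytingCommutativeRing)
open import Algebra.Morphism.Structures using (IsRingHomomorphism)
import Algebra.Definitions.RawSemiring as RawSemiringDefs
open import Data.Bool.Base using (if_then_else_)
open import Data.Integer.Base as ℤ using (ℤ; 0ℤ; 1ℤ)
open import Data.List.Base as List using (List; []; _∷_; _++_; [_]; foldr; replicate)
open import Data.Nat.Base as ℕ using (ℕ; zero; suc; _≤_; _<_; _∸_)
open import Data.Nat.Divisibility using (_∣_)
open import Data.Nat.Properties using (_≟_)
open import Data.Product.Base using (∃₂; ∃-syntax; _×_; _,_)
open import Data.Rational.Base as ℚ using (ℚ; ↥_; ↧ₙ_)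
open import Data.Vec.Base as Vec using (Vec; []; _∷_)
open import Data.Vec.Properties using (≡-dec)
open import Relation.Binary.PropositionalEquality.Core using (_≡_; _≢_)
open import Relation.Nullary.Decidable.Core using (does)
open import Relation.Nullary.Negation.Core using (¬_)
open import Relation.Unary using (Pred)

private
  variable
    c ℓ₁ ℓ₂ : Level

fromℤ : ℤ → ℚ
fromℤ z = z ℚ./ 1

-- One-variable polynomials, as lists of coefficients in ascending order.
-- Trailing zeros are allowed, so lists are compared through `coeff`.
module UnivariateOver {c ℓ} (R : RawRing c ℓ) where

  open RawRing R renaming (Carrier to A)

  infixl 6 _+ₚ_
  infixl 7 _*ₚ_
  infix  4 _≈ₚ_

  coeff : List A → ℕ → A
  coeff []      _       = 0#
  coeff (a ∷ f) zero    = a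
  coeff (a ∷ f) (suc i) = coeff f i

  _≈ₚ_ : List A → List A → Set ℓ
  f ≈ₚ g = ∀ i → coeff f i ≈ coeff g i

  _+ₚ_ : List A → List A → List A
  []      +ₚ g       = g
  (a ∷ f) +ₚ []      = a ∷ f
  (a ∷ f) +ₚ (b ∷ g) = a + b ∷ f +ₚ g

  _*ₚ_ : List A → List A → List A
  []      *ₚ g = []
  (a ∷ f) *ₚ g = List.map (a *_) g +ₚ (0# ∷ f *ₚ g)

  -- c xᵉ
  term : A → ℕ → List A
  term c e = replicate e 0# ++ [ c ]

  evaluate : List A → A → A
  evaluate []      x = 0#
  evaluate (a ∷ f) x = a + x * evaluate f x

-- Polynomials over ℤ in n variables, as formal sums of terms c · x₁^e₁ ⋯ xₙ^eₙ.
-- Exponent vectors may repeat, so the coefficient of a monomial is a sum.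
Polynomial : ℕ → Set
Polynomial n = List (ℤ × Vec ℕ n)

coefficient : ∀ {n} → Polynomial n → Vec ℕ n → ℤ
coefficient F e =
  foldr (λ (c , e′) s → if does (≡-dec _≟_ e e′) then c ℤ.+ s else s) 0ℤ F

IsHomogeneous : ∀ {n} → ℕ → Polynomial n → Set
IsHomogeneous d F = ∀ e → coefficient F e ≢ 0ℤ → Vec.sum e ≡ d

monomial : ∀ {n} → Vec ℤ n → Vec ℕ n → ℤ
monomial []       []       = 1ℤ
monomial (x ∷ xs) (e ∷ es) = x ℤ.^ e ℤ.* monomial xs es

eval : ∀ {n} → Polynomial n → Vec ℤ n → ℤ
eval F x = foldr (λ (c , e) s → c ℤ.* monomial x e ℤ.+ s) 0ℤ F

-- F(x, a₁, …, aₙ₋₁) ∈ ℤ[x]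
specialise : ∀ {n} → Polynomial (suc n) → Vec ℤ n → List ℤ
specialise F a =
  foldr (λ { (c , e ∷ es) f → term (c ℤ.* monomial a es) e +ₚ f }) [] F
  where open UnivariateOver ℤ.+-*-rawRing

RatioSet : ∀ {n} → Polynomial n → Pred ℚ 0ℓ
RatioSet F r = ∃₂ λ x y →
  eval F y ≢ 0ℤ × r ℚ.* fromℤ (eval F y) ≡ fromℤ (eval F x)

-- "Non-zero" in a Heyting field means apart from zero, i.e. invertible.
module OverField (K : HeytingField c ℓ₁ ℓ₂) where

  open HeytingField K public
  private
    rawRing′ : RawRing c ℓ₁
    rawRing′ = CommutativeRing.rawRing
      (HeytingCommutativeRing.commutativeRing heytingCommutativeRing)

  open UnivariateOver rawRing′ public
  open RawSemiringDefs (RawRing.rawSemiring rawRing′) public using (_^_)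

  HasDegree : List Carrier → ℕ → Set (ℓ₁ ⊔ ℓ₂)
  HasDegree f m = coeff f m # 0# × (∀ i → m < i → coeff f i ≈ 0#)

  -- ∏ᵢ (x - rᵢ)
  fromRoots : ∀ {m} → Vec Carrier m → List Carrier
  fromRoots = Vec.foldr′ (λ r f → (- r ∷ 1# ∷ []) *ₚ f) [ 1# ]

  -- ∏_{i<j} (rᵢ - rⱼ)²
  squaredDifferences : ∀ {m} → Vec Carrier m → Carrier
  squaredDifferences []       = 1#
  squaredDifferences (r ∷ rs) =
    Vec.foldr′ (λ s y → (r - s) ^ 2 * y) 1# rs * squaredDifferences rs

  -- D is the discriminant of f, computed from its roots (listed with
  -- multiplicity) in K.  Discriminants are defined only for degree m ≥ 1, where
  -- the truncated subtraction 2m ∸ 2 is exact.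
  record IsDiscriminant (f : List Carrier) (D : Carrier) : Set (c ⊔ ℓ₁ ⊔ ℓ₂) where
    field
      m             : ℕ
      m≥1           : 1 ≤ m
      degree        : HasDegree f m
      roots         : Vec Carrier m
      factorisation : f ≈ₚ List.map (coeff f m *_) (fromRoots roots)
      value         : D ≈ coeff f m ^ (2 ℕ.* m ∸ 2) * squaredDifferences roots

  IsAlgebraicallyClosed : Set (c ⊔ ℓ₁ ⊔ ℓ₂)
  IsAlgebraicallyClosed =
    ∀ f m → 1 ≤ m → HasDegree f m → ∃[ x ] evaluate f x ≈ 0#

record AlgebraicClosureOfℚ c ℓ₁ ℓ₂ : Set (lsuc (c ⊔ ℓ₁ ⊔ ℓ₂)) where
  field
    field′ : HeytingField c ℓ₁ ℓ₂

  open OverField field′ public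

  field
    ι             : ℚ → Carrier
    ι-homomorphic : IsRingHomomorphism ℚ.+-*-rawRing
                      (CommutativeRing.rawRing
                        (HeytingCommutativeRing.commutativeRing heytingCommutativeRing)) ι
    algebraic     : ∀ x → ∃₂ λ f m →
                      HasDegree (List.map ι f) m × evaluate (List.map ι f) x ≈ 0#
    closed        : IsAlgebraicallyClosed

HasNonZeroDiscriminant : AlgebraicClosureOfℚ c ℓ₁ ℓ₂ → List ℤ → Set (c ⊔ ℓ₁ ⊔ ℓ₂)
HasNonZeroDiscriminant K f =
  ∃[ D ] IsDiscriminant (List.map (λ z → ι (fromℤ z)) f) D × D # 0#
  where open AlgebraicClosureOfℚ K

-- |q|ₚ ≤ p⁻ᵏ for k ≥ 0, read off the lowest-terms representation of q.
NormBound : (p k : ℕ) → ℚ → Set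
NormBound p k q = (p ℕ.^ k ∣ ℤ.∣ ↥ q ∣) × ¬ (p ∣ ↧ₙ q)

-- ℚₚ as the completion of ℚ: its elements are represented by p-adic Cauchy
-- sequences.  Sequences with the same limit lie in the same balls, so no
-- quotient is needed to speak of density.
record Padic (p : ℕ) : Set where
  field
    seq    : ℕ → ℚ
    cauchy : ∀ k → ∃[ N ] ∀ i j → N ≤ i → N ≤ j → NormBound p k (seq i ℚ.- seq j)

-- |α - r|ₚ ≤ p⁻ᵏ.  By the ultrametric inequality, |seq i - r|ₚ is eventually
-- constant or tends to 0, so a bound on the limit is an eventual bound.
WithinBall : ∀ {p} → Padic p → ℕ → ℚ → Set
WithinBall {p} α k r = ∃[ N ] ∀ i → N ≤ i → NormBound p k (seq i ℚ.- r)
  where open Padic α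

DenseInℚₚ : ℕ → Pred ℚ 0ℓ → Set
DenseInℚₚ p S = (α : Padic p) (k : ℕ) → ∃[ r ] S r × WithinBall α k r

{-# OPTIONS --safe #-}
module Submission where

-- Put f(x) = F(x, a).  Since f has only simple roots in the algebraic closure,
-- the Euclidean algorithm in ℤ[x] applied to f and f′ cannot end in a common
-- root, so it ends in a non-zero integer Δ in the ideal (f, f′).  By Schur's
-- argument infinitely many primes p divide a value f(x₀); if p does not divide
-- Δ, then p does not divide f′(x₀), and by Hensel's lemma f takes values
-- arbitrarily close to every element of pℤₚ.  Given a / b ∈ ℚ, values f(x) and
-- f(y) close to p a and p b have a ratio close to a / b.

open import Defs
open import Algebra.Apartness.Bundles using (HeytingField; HeytingCommutativeRing)
open import Algebra.Bundles using (CommutativeRing)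
import Algebra.Morphism.Construct.Composition as Composition
import Algebra.Morphism.Construct.Identity as Identity
open import Algebra.Morphism.Structures using (IsRingHomomorphism)
open import Data.Empty using (⊥-elim)
open import Data.Integer.Base as ℤ using (ℤ; +_; 0ℤ; 1ℤ; ∣_∣)
open import Data.Integer.Divisibility.Signed
open import Data.Integer.Properties as ℤ using ()
open import Data.Integer.Tactic.RingSolver using (solve-∀)
open import Data.List.Base as List using (List; []; _∷_; _++_; [_]; replicate; length)
open import Data.List.Properties using (map-id; length-map; length-++; length-replicate)
open import Data.List.Relation.Unary.All using (_∷_)
open import Data.Nat.Base as ℕ
  using (ℕ; zero; suc; _≤_; _<_; _!; _∸_; z≤n; s≤s; z<s; NonZero)
open import Data.Nat.Coprimality as Coprime using (Coprime; coprime-Bézout)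
import Data.Nat.Divisibility as ℕ
import Data.Nat.GCD as ℕ
open import Data.Nat.Primality
  using (Prime; euclidsLemma; prime⇒irreducible; prime⇒nonZero; prime⇒nonTrivial; ¬prime[1])
open import Data.Nat.Primality.Factorisation using (factorise)
import Data.Nat.Properties as ℕ
open import Data.Product.Base using (∃; ∃₂; ∃-syntax; _×_; _,_; proj₁; proj₂; swap; map₂)
open import Data.Rational.Base as ℚ using (ℚ; 1ℚ; mkℚ; ↥_; ↧_; ↧ₙ_; toℚᵘ)
import Data.Rational.Properties as ℚ
import Data.Rational.Solver as ℚ
open import Data.Rational.Unnormalised.Base as ℚᵘ using (mkℚᵘ; *≡*; _≃_)
import Data.Rational.Unnormalised.Properties as ℚᵘ
open import Data.Sum.Base as Sum using (_⊎_; inj₁; inj₂)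
open import Data.Vec.Base as Vec using (Vec; []; _∷_)
open import Relation.Binary.PropositionalEquality as ≡ using (_≡_; _≢_)
open import Relation.Nullary.Decidable using (Dec; yes; no)
open import Relation.Nullary.Negation using (¬_; contradiction)

-- Equality in `K` is not assumed decidable; it is known only through a tight apartness relation.
-- Leading coefficients are therefore found in ℤ, where equality can be tested, and a common root of
-- f and f′ in `K` only has to be refuted. Inside such a refutation an equation in `K` may be proved
-- by refuting apartness, which replaces the usual case distinctions. Division is avoided too: a
-- Euclidean step multiplies crosswise by leading coefficients, which are non-zero integers and so
-- invertible in `K`.
--
-- The targets are p a and p b, not a and b, because the simple root modulo p gives control only
-- over the residue class 0; the factor p cancels in the quotient. Valuations are never computed,
-- only bounded from above, and for the denominator b the inequality b < p^b is bound enough.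

module Rearrangements {c ℓ} (R : CommutativeRing c ℓ) where

  open CommutativeRing R
  open import Algebra.Solver.Ring.NaturalCoefficients.Default commutativeSemiring
    using (solve; _:+_; _:*_; _:=_)

  evaluate-step : ∀ a x h y s q →
    a + (x + h) * (y + h * (s + h * q)) ≈ a + x * y + h * (y + x * s + h * (s + h * q + x * q))
  evaluate-step = solve 6 (λ a x h y s q →
    a :+ (x :+ h) :* (y :+ h :* (s :+ h :* q)) :=
    a :+ x :* y :+ h :* (y :+ x :* s :+ h :* (s :+ h :* q :+ x :* q))) refl

  slope-step : ∀ x h y s u r →
    y + h * u + (x + h) * (s + h * r) ≈ y + x * s + h * (u + s + h * r + x * r)
  slope-step = solve 6 (λ x h y s u r →
    y :+ h :* u :+ (x :+ h) :* (s :+ h :* r) :=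
    y :+ x :* s :+ h :* (u :+ s :+ h :* r :+ x :* r)) refl

  add-step : ∀ a b x y z → a + b + x * (y + z) ≈ a + x * y + (b + x * z)
  add-step = solve 5 (λ a b x y z →
    a :+ b :+ x :* (y :+ z) :=
    a :+ x :* y :+ (b :+ x :* z)) refl

  scale-step : ∀ a b x y → a * b + x * (a * y) ≈ a * (b + x * y)
  scale-step = solve 4 (λ a b x y →
    a :* b :+ x :* (a :* y) :=
    a :* (b :+ x :* y)) refl

  snoc-step : ∀ b x y p a → b + x * (y + p * a) ≈ b + x * y + x * p * a
  snoc-step = solve 5 (λ b x y p a →
    b :+ x :* (y :+ p :* a) :=
    b :+ x :* y :+ x :* p :* a) refl

-- Formal derivatives and Taylor expansion

module Slope {c ℓ} (R : CommutativeRing c ℓ) where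
  open CommutativeRing R
  open UnivariateOver rawRing public
  open import Relation.Binary.Reasoning.Setoid setoid

  open Rearrangements R

  -- f′(x), by Horner's rule (a + x f)′ = f + x f′.
  slope : List Carrier → Carrier → Carrier
  slope []      x = 0#
  slope (a ∷ f) x = evaluate f x + x * slope f x

  -- The Euclidean algorithm needs f′ as a coefficient list, whereas Newton's step only needs its
  -- values `slope`; `⟦⟧-derivative` connects the two.
  derivative : List Carrier → List Carrier
  derivative []      = []
  derivative (a ∷ f) = f +ₚ (0# ∷ derivative f)

  -- Taylor's formula to second order for f and to first order for f′. The remainders are left
  -- unspecified, so no division by factorials arises and any commutative ring will do.
  evaluate-+ : ∀ f x h → ∃ λ q → evaluate f (x + h) ≈ evaluate f x + h * (slope f x + h * q)
  slope-+ : ∀ f x h → ∃ λ q → slope f (x + h) ≈ slope f x + h * q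

  evaluate-+ []      x h = 0# , (begin
    0#                    ≈⟨ zeroʳ h ⟨
    h * 0#                ≈⟨ *-congˡ (zeroʳ h) ⟨
    h * (h * 0#)          ≈⟨ *-congˡ (+-identityˡ _) ⟨
    h * (0# + h * 0#)     ≈⟨ +-identityˡ _ ⟨
    0# + h * (0# + h * 0#) ∎)
  evaluate-+ (a ∷ f) x h = let q , eq = evaluate-+ f x h in
    slope f x + h * q + x * q , (begin
      a + (x + h) * evaluate f (x + h)
        ≈⟨ +-congˡ (*-congˡ eq) ⟩
      a + (x + h) * (evaluate f x + h * (slope f x + h * q))
        ≈⟨ evaluate-step a x h (evaluate f x) (slope f x) q ⟩
      a + x * evaluate f x + h * (evaluate f x + x * slope f x + h * (slope f x + h * q + x * q)) ∎)

  slope-+ []      x h = 0# , sym (trans (+-identityˡ _) (zeroʳ h))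
  slope-+ (a ∷ f) x h =
    let q , eq = evaluate-+ f x h ; r , eq′ = slope-+ f x h in
    slope f x + h * q + slope f x + h * r + x * r , (begin
      evaluate f (x + h) + (x + h) * slope f (x + h)
        ≈⟨ +-cong eq (*-congˡ eq′) ⟩
      evaluate f x + h * (slope f x + h * q) + (x + h) * (slope f x + h * r)
        ≈⟨ slope-step x h (evaluate f x) (slope f x) (slope f x + h * q) r ⟩
      evaluate f x + x * slope f x + h * (slope f x + h * q + slope f x + h * r + x * r) ∎)

-- Evaluation along a ring homomorphism

module Evaluation {c ℓ c′ ℓ′} (R : CommutativeRing c ℓ) (S : CommutativeRing c′ ℓ′)
  {φ : CommutativeRing.Carrier R → CommutativeRing.Carrier S}
  (homomorphic : IsRingHomomorphism (CommutativeRing.rawRing R) (CommutativeRing.rawRing S) φ)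
  where

  private
    module R = CommutativeRing R
  open Slope R using (coeff; _≈ₚ_; _+ₚ_; derivative)
  open CommutativeRing S
  open Slope S using (evaluate; slope) renaming (coeff to coeffₛ)
  open IsRingHomomorphism homomorphic
  open import Relation.Binary.Reasoning.Setoid setoid

  open Rearrangements S

  -- Coefficients lie in `R` and the point in `S`, so one set of lemmas serves ℤ → ℤ, ℤ → `K` and
  -- `K` → `K`. For an identity map `List.map φ f` is still not `f` by definition, whence the later
  -- uses of `map-id`.
  ⟦_⟧ ⟦_⟧′ : List R.Carrier → Carrier → Carrier
  ⟦ f ⟧  = evaluate (List.map φ f)
  ⟦ f ⟧′ = slope (List.map φ f)

  coeff-map : ∀ f i → coeffₛ (List.map φ f) i ≈ φ (coeff f i)
  coeff-map []      i       = sym 0#-homo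
  coeff-map (a ∷ f) zero    = refl
  coeff-map (a ∷ f) (suc i) = coeff-map f i

  private
    cons≈[] : ∀ {a y} x → φ a ≈ 0# → y ≈ 0# → φ a + x * y ≈ 0#
    cons≈[] x a≈0 y≈0 =
      trans (+-cong a≈0 (trans (*-congˡ y≈0) (zeroʳ x))) (+-identityˡ 0#)

  ⟦⟧-zero : ∀ f → f ≈ₚ [] → ∀ x → ⟦ f ⟧ x ≈ 0#
  ⟦⟧-zero []      f≈0 x = refl
  ⟦⟧-zero (a ∷ f) f≈0 x =
    cons≈[] x (trans (⟦⟧-cong (f≈0 0)) 0#-homo) (⟦⟧-zero f (λ i → f≈0 (suc i)) x)

  ⟦⟧-congₚ : ∀ f g → f ≈ₚ g → ∀ x → ⟦ f ⟧ x ≈ ⟦ g ⟧ x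
  ⟦⟧-congₚ []      g       f≈g x = sym (⟦⟧-zero g (λ i → R.sym (f≈g i)) x)
  ⟦⟧-congₚ (a ∷ f) []      f≈g x = ⟦⟧-zero (a ∷ f) f≈g x
  ⟦⟧-congₚ (a ∷ f) (b ∷ g) f≈g x =
    +-cong (⟦⟧-cong (f≈g 0)) (*-congˡ (⟦⟧-congₚ f g (λ i → f≈g (suc i)) x))

  ⟦⟧′-zero : ∀ f → f ≈ₚ [] → ∀ x → ⟦ f ⟧′ x ≈ 0#
  ⟦⟧′-zero []      f≈0 x = refl
  ⟦⟧′-zero (a ∷ f) f≈0 x = let f≈0′ = λ i → f≈0 (suc i) in begin
    ⟦ f ⟧ x + x * ⟦ f ⟧′ x ≈⟨ +-cong (⟦⟧-zero f f≈0′ x) (*-congˡ (⟦⟧′-zero f f≈0′ x)) ⟩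
    0# + x * 0#            ≈⟨ trans (+-identityˡ _) (zeroʳ x) ⟩
    0#                     ∎

  ⟦⟧′-congₚ : ∀ f g → f ≈ₚ g → ∀ x → ⟦ f ⟧′ x ≈ ⟦ g ⟧′ x
  ⟦⟧′-congₚ []      g       f≈g x = sym (⟦⟧′-zero g (λ i → R.sym (f≈g i)) x)
  ⟦⟧′-congₚ (a ∷ f) []      f≈g x = ⟦⟧′-zero (a ∷ f) f≈g x
  ⟦⟧′-congₚ (a ∷ f) (b ∷ g) f≈g x = let f≈g′ = λ i → f≈g (suc i) in
    +-cong (⟦⟧-congₚ f g f≈g′ x) (*-congˡ (⟦⟧′-congₚ f g f≈g′ x))

  ⟦⟧-+ₚ : ∀ f g x → ⟦ f +ₚ g ⟧ x ≈ ⟦ f ⟧ x + ⟦ g ⟧ x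
  ⟦⟧-+ₚ []      g       x = sym (+-identityˡ _)
  ⟦⟧-+ₚ (a ∷ f) []      x = sym (+-identityʳ _)
  ⟦⟧-+ₚ (a ∷ f) (b ∷ g) x = begin
    φ (a R.+ b) + x * ⟦ f +ₚ g ⟧ x          ≈⟨ +-cong (+-homo a b) (*-congˡ (⟦⟧-+ₚ f g x)) ⟩
    φ a + φ b + x * (⟦ f ⟧ x + ⟦ g ⟧ x)     ≈⟨ add-step (φ a) (φ b) x (⟦ f ⟧ x) (⟦ g ⟧ x) ⟩
    φ a + x * ⟦ f ⟧ x + (φ b + x * ⟦ g ⟧ x) ∎

  ⟦⟧′-+ₚ : ∀ f g x → ⟦ f +ₚ g ⟧′ x ≈ ⟦ f ⟧′ x + ⟦ g ⟧′ x
  ⟦⟧′-+ₚ []      g       x = sym (+-identityˡ _)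
  ⟦⟧′-+ₚ (a ∷ f) []      x = sym (+-identityʳ _)
  ⟦⟧′-+ₚ (a ∷ f) (b ∷ g) x = begin
    ⟦ f +ₚ g ⟧ x + x * ⟦ f +ₚ g ⟧′ x
      ≈⟨ +-cong (⟦⟧-+ₚ f g x) (*-congˡ (⟦⟧′-+ₚ f g x)) ⟩
    ⟦ f ⟧ x + ⟦ g ⟧ x + x * (⟦ f ⟧′ x + ⟦ g ⟧′ x)
      ≈⟨ add-step (⟦ f ⟧ x) (⟦ g ⟧ x) x (⟦ f ⟧′ x) (⟦ g ⟧′ x) ⟩
    ⟦ f ⟧ x + x * ⟦ f ⟧′ x + (⟦ g ⟧ x + x * ⟦ g ⟧′ x) ∎

  ⟦⟧-scale : ∀ a f x → ⟦ List.map (a R.*_) f ⟧ x ≈ φ a * ⟦ f ⟧ x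
  ⟦⟧-scale a []      x = sym (zeroʳ _)
  ⟦⟧-scale a (b ∷ f) x = begin
    φ (a R.* b) + x * ⟦ List.map (a R.*_) f ⟧ x ≈⟨ +-cong (*-homo a b) (*-congˡ (⟦⟧-scale a f x)) ⟩
    φ a * φ b + x * (φ a * ⟦ f ⟧ x)             ≈⟨ scale-step (φ a) (φ b) x (⟦ f ⟧ x) ⟩
    φ a * (φ b + x * ⟦ f ⟧ x)                   ∎

  ⟦⟧′-scale : ∀ a f x → ⟦ List.map (a R.*_) f ⟧′ x ≈ φ a * ⟦ f ⟧′ x
  ⟦⟧′-scale a []      x = sym (zeroʳ _)
  ⟦⟧′-scale a (b ∷ f) x = begin
    ⟦ List.map (a R.*_) f ⟧ x + x * ⟦ List.map (a R.*_) f ⟧′ x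
      ≈⟨ +-cong (⟦⟧-scale a f x) (*-congˡ (⟦⟧′-scale a f x)) ⟩
    φ a * ⟦ f ⟧ x + x * (φ a * ⟦ f ⟧′ x)
      ≈⟨ scale-step (φ a) (⟦ f ⟧ x) x (⟦ f ⟧′ x) ⟩
    φ a * (⟦ f ⟧ x + x * ⟦ f ⟧′ x) ∎

  ⟦⟧-derivative : ∀ f x → ⟦ derivative f ⟧ x ≈ ⟦ f ⟧′ x
  ⟦⟧-derivative []      x = refl
  ⟦⟧-derivative (a ∷ f) x = begin
    ⟦ f +ₚ (R.0# ∷ derivative f) ⟧ x          ≈⟨ ⟦⟧-+ₚ f (R.0# ∷ derivative f) x ⟩
    ⟦ f ⟧ x + (φ R.0# + x * ⟦ derivative f ⟧ x) ≈⟨ +-congˡ (+-cong 0#-homo (*-congˡ (⟦⟧-derivative f x))) ⟩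
    ⟦ f ⟧ x + (0# + x * ⟦ f ⟧′ x)             ≈⟨ +-congˡ (+-identityˡ _) ⟩
    ⟦ f ⟧ x + x * ⟦ f ⟧′ x                    ∎

  power : Carrier → ℕ → Carrier
  power x zero    = 1#
  power x (suc n) = x * power x n

  ⟦⟧-shift : ∀ k f x → ⟦ replicate k R.0# ++ f ⟧ x ≈ power x k * ⟦ f ⟧ x
  ⟦⟧-shift zero    f x = sym (*-identityˡ _)
  ⟦⟧-shift (suc k) f x = begin
    φ R.0# + x * ⟦ replicate k R.0# ++ f ⟧ x ≈⟨ +-cong 0#-homo (*-congˡ (⟦⟧-shift k f x)) ⟩
    0# + x * (power x k * ⟦ f ⟧ x)           ≈⟨ +-identityˡ _ ⟩
    x * (power x k * ⟦ f ⟧ x)                ≈⟨ *-assoc x _ _ ⟨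
    x * power x k * ⟦ f ⟧ x                  ∎

  -- Lists ascend in degree, so this splits off the leading term, of degree `length f`.
  ⟦⟧-snoc : ∀ f a x → ⟦ f ++ [ a ] ⟧ x ≈ ⟦ f ⟧ x + power x (length f) * φ a
  ⟦⟧-snoc []      a x = begin
    φ a + x * 0#    ≈⟨ +-congˡ (zeroʳ x) ⟩
    φ a + 0#        ≈⟨ +-comm _ _ ⟩
    0# + φ a        ≈⟨ +-congˡ (*-identityˡ _) ⟨
    0# + 1# * φ a   ∎
  ⟦⟧-snoc (b ∷ f) a x = begin
    φ b + x * ⟦ f ++ [ a ] ⟧ x                     ≈⟨ +-congˡ (*-congˡ (⟦⟧-snoc f a x)) ⟩
    φ b + x * (⟦ f ⟧ x + power x (length f) * φ a) ≈⟨ snoc-step (φ b) x (⟦ f ⟧ x) _ (φ a) ⟩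
    φ b + x * ⟦ f ⟧ x + x * power x (length f) * φ a ∎

-- Cancellation in a Heyting field

module HeytingFieldProperties {c ℓ₁ ℓ₂} (H : HeytingField c ℓ₁ ℓ₂) where
  open HeytingField H
  open import Algebra.Apartness.Properties.HeytingCommutativeRing heytingCommutativeRing public

  commutativeRing : CommutativeRing c ℓ₁
  commutativeRing = HeytingCommutativeRing.commutativeRing heytingCommutativeRing

  open import Relation.Binary.Reasoning.Setoid setoid

  ≈⇒¬# : ∀ {x y} → x ≈ y → ¬ x # y
  ≈⇒¬# = proj₂ (tight _ _)

  x*y≈0∧y#0⇒x≈0 : ∀ {x y} → x * y ≈ 0# → y # 0# → x ≈ 0#
  x*y≈0∧y#0⇒x≈0 {x} {y} xy≈0 y#0 = let y⁻¹ , _ , y-0*y⁻¹≈1 = #⇒invertible y#0 in begin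
    x                    ≈⟨ *-identityʳ x ⟨
    x * 1#               ≈⟨ *-congˡ y-0*y⁻¹≈1 ⟨
    x * ((y - 0#) * y⁻¹) ≈⟨ *-congˡ (*-congʳ (x-0≈x y)) ⟩
    x * (y * y⁻¹)        ≈⟨ *-assoc x y y⁻¹ ⟨
    x * y * y⁻¹          ≈⟨ *-congʳ xy≈0 ⟩
    0# * y⁻¹             ≈⟨ zeroˡ y⁻¹ ⟩
    0#                   ∎

  x*y≈1⇒x#0 : ∀ {x y} → x * y ≈ 1# → x # 0#
  x*y≈1⇒x#0 {x} {y} xy≈1 = invertibleʳ⇒# (y , trans (*-congʳ (x-0≈x x)) xy≈1)

  -- An inverse of x y, multiplied by y, is an inverse of x. This lets a non-zero discriminant pass
  -- apartness on to each of its factors.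
  x*y#0⇒x#0 : ∀ {x y} → x * y # 0# → x # 0#
  x*y#0⇒x#0 {x} {y} xy#0 = let z , _ , xy-0*z≈1 = #⇒invertible xy#0 in
    x*y≈1⇒x#0 {y = y * z} (begin
      x * (y * z)        ≈⟨ *-assoc x y z ⟨
      x * y * z          ≈⟨ *-congʳ (x-0≈x (x * y)) ⟨
      (x * y - 0#) * z   ≈⟨ xy-0*z≈1 ⟩
      1#                 ∎)

  x*y#0⇒y#0 : ∀ {x y} → x * y # 0# → y # 0#
  x*y#0⇒y#0 {x} {y} xy#0 = x*y#0⇒x#0 (#-congʳ (*-comm x y) xy#0)

  x-y≈0⇒x≈y : ∀ {x y} → x - y ≈ 0# → x ≈ y
  x-y≈0⇒x≈y {x} {y} x-y≈0 = begin
    x               ≈⟨ +-identityʳ x ⟨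
    x + 0#          ≈⟨ +-congˡ (-‿inverseˡ y) ⟨
    x + (- y + y)   ≈⟨ +-assoc x (- y) y ⟨
    x - y + y       ≈⟨ +-congʳ x-y≈0 ⟩
    0# + y          ≈⟨ +-identityˡ y ⟩
    y               ∎

-- A non-zero discriminant excludes multiple roots

module SimpleRoots {c ℓ₁ ℓ₂} (H : HeytingField c ℓ₁ ℓ₂) where
  open OverField H
  open HeytingFieldProperties H
  open CommutativeRing commutativeRing using (rawRing; commutativeSemiring)
  open Slope commutativeRing using (slope)
  open Evaluation commutativeRing commutativeRing (Identity.isRingHomomorphism rawRing refl)
  open import Relation.Binary.Reasoning.Setoid setoid
  open import Algebra.Solver.Ring.NaturalCoefficients.Default commutativeSemiring
    using (solve; con; _:+_; _:*_; _:=_)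

  ⟦⟧-linear-* : ∀ r f x → ⟦ (- r ∷ 1# ∷ []) *ₚ f ⟧ x ≈ (x - r) * ⟦ f ⟧ x
  ⟦⟧-linear-* r f x = begin
    ⟦ (- r ∷ 1# ∷ []) *ₚ f ⟧ x
      ≈⟨ ⟦⟧-+ₚ (List.map (- r *_) f) _ x ⟩
    ⟦ List.map (- r *_) f ⟧ x + (0# + x * ⟦ List.map (1# *_) f +ₚ [ 0# ] ⟧ x)
      ≈⟨ +-cong (⟦⟧-scale (- r) f x)
           (+-congˡ (*-congˡ (trans (⟦⟧-+ₚ (List.map (1# *_) f) [ 0# ] x) (+-congʳ (⟦⟧-scale 1# f x))))) ⟩
    - r * ⟦ f ⟧ x + (0# + x * (1# * ⟦ f ⟧ x + (0# + x * 0#)))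
      ≈⟨ solve 3 (λ -r x y → -r :* y :+ (con 0 :+ x :* (con 1 :* y :+ (con 0 :+ x :* con 0)))
           := (x :+ -r) :* y) refl (- r) x (⟦ f ⟧ x) ⟩
    (x - r) * ⟦ f ⟧ x ∎

  ⟦⟧′-linear-* : ∀ r f x → ⟦ (- r ∷ 1# ∷ []) *ₚ f ⟧′ x ≈ ⟦ f ⟧ x + (x - r) * ⟦ f ⟧′ x
  ⟦⟧′-linear-* r f x = begin
    ⟦ (- r ∷ 1# ∷ []) *ₚ f ⟧′ x
      ≈⟨ ⟦⟧′-+ₚ (List.map (- r *_) f) _ x ⟩
    ⟦ List.map (- r *_) f ⟧′ x + (⟦ List.map (1# *_) f +ₚ [ 0# ] ⟧ x + x * ⟦ List.map (1# *_) f +ₚ [ 0# ] ⟧′ x)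
      ≈⟨ +-cong (⟦⟧′-scale (- r) f x)
           (+-cong (trans (⟦⟧-+ₚ (List.map (1# *_) f) [ 0# ] x) (+-congʳ (⟦⟧-scale 1# f x)))
             (*-congˡ (trans (⟦⟧′-+ₚ (List.map (1# *_) f) [ 0# ] x) (+-congʳ (⟦⟧′-scale 1# f x))))) ⟩
    - r * ⟦ f ⟧′ x + (1# * ⟦ f ⟧ x + (0# + x * 0#) + x * (1# * ⟦ f ⟧′ x + (0# + x * 0#)))
      ≈⟨ solve 4 (λ -r x y z → -r :* z :+ (con 1 :* y :+ (con 0 :+ x :* con 0)
             :+ x :* (con 1 :* z :+ (con 0 :+ x :* con 0)))
           := y :+ (x :+ -r) :* z) refl (- r) x (⟦ f ⟧ x) (⟦ f ⟧′ x) ⟩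
    ⟦ f ⟧ x + (x - r) * ⟦ f ⟧′ x ∎

  -- The part of the discriminant that pairs `r` with the other roots becomes the square of their
  -- polynomial at `r`, so it vanishes as soon as `r` is a root of the cofactor.
  ∏[r-rᵢ]²≈fromRoots² : ∀ {m} r (rs : Vec Carrier m) →
    Vec.foldr′ (λ s y → (r - s) ^ 2 * y) 1# rs ≈ ⟦ fromRoots rs ⟧ r * ⟦ fromRoots rs ⟧ r
  ∏[r-rᵢ]²≈fromRoots² r []       =
    solve 1 (λ r → con 1 := (con 1 :+ r :* con 0) :* (con 1 :+ r :* con 0)) refl r
  ∏[r-rᵢ]²≈fromRoots² r (s ∷ rs) = let y = ⟦ fromRoots rs ⟧ r in begin
    (r - s) ^ 2 * _                     ≈⟨ *-congˡ (∏[r-rᵢ]²≈fromRoots² r rs) ⟩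
    (r - s) ^ 2 * (y * y)               ≈⟨ solve 2 (λ d y →
                                             d :* (d :* con 1) :* (y :* y) := d :* y :* (d :* y)) refl (r - s) y ⟩
    (r - s) * y * ((r - s) * y)         ≈⟨ *-cong (⟦⟧-linear-* s (fromRoots rs) r) (⟦⟧-linear-* s (fromRoots rs) r) ⟨
    ⟦ fromRoots (s ∷ rs) ⟧ r * ⟦ fromRoots (s ∷ rs) ⟧ r ∎

  -- Write P = (X - r) Q, so that P′ = Q + (X - r) Q′. A common zero of P and P′ turns out to be one
  -- of Q and Q′, which the induction hypothesis forbids. Since x = r cannot be decided, both
  -- vanishings come from tightness.
  fromRoots-simple : ∀ {m} (rs : Vec Carrier m) → squaredDifferences rs # 0# →
    ∀ x → ⟦ fromRoots rs ⟧ x ≈ 0# → ¬ ⟦ fromRoots rs ⟧′ x ≈ 0#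
  fromRoots-simple []       _   x 1≈0  _    =
    ≈⇒¬# (trans (sym (trans (+-congˡ (zeroʳ x)) (+-identityʳ 1#))) 1≈0) 1#0
  fromRoots-simple (r ∷ rs) d#0 x P≈0 P′≈0 =
    fromRoots-simple rs (x*y#0⇒y#0 d#0) x Q≈0 Q′≈0
    where
    Q = ⟦ fromRoots rs ⟧
    Q′ = ⟦ fromRoots rs ⟧′

    [x-r]Q≈0 : (x - r) * Q x ≈ 0#
    [x-r]Q≈0 = trans (sym (⟦⟧-linear-* r (fromRoots rs) x)) P≈0

    Q+[x-r]Q′≈0 : Q x + (x - r) * Q′ x ≈ 0#
    Q+[x-r]Q′≈0 = trans (sym (⟦⟧′-linear-* r (fromRoots rs) x)) P′≈0

    Q≈0 : Q x ≈ 0#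
    -- If Q(x) were apart from 0, then x - r = 0, which leaves P′(x) = Q(x) = 0.
    Q≈0 = proj₁ (tight _ _) λ Q#0 → ≈⇒¬# (begin
      Q x                     ≈⟨ +-identityʳ _ ⟨
      Q x + 0#                ≈⟨ +-congˡ (trans (*-congʳ (x*y≈0∧y#0⇒x≈0 [x-r]Q≈0 Q#0)) (zeroˡ _)) ⟨
      Q x + (x - r) * Q′ x    ≈⟨ Q+[x-r]Q′≈0 ⟩
      0#                      ∎) Q#0

    [x-r]Q′≈0 : (x - r) * Q′ x ≈ 0#
    [x-r]Q′≈0 = begin
      (x - r) * Q′ x          ≈⟨ +-identityˡ _ ⟨
      0# + (x - r) * Q′ x     ≈⟨ +-congʳ Q≈0 ⟨
      Q x + (x - r) * Q′ x    ≈⟨ Q+[x-r]Q′≈0 ⟩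
      0#                      ∎

    Q′≈0 : Q′ x ≈ 0#
    -- If Q′(x) were apart from 0, then x = r and Q(r) = 0, so `r` would be a repeated root and the
    -- discriminant would vanish.
    Q′≈0 = proj₁ (tight _ _) λ Q′#0 →
      let x≈r = x-y≈0⇒x≈y (x*y≈0∧y#0⇒x≈0 [x-r]Q′≈0 Q′#0)
          Q[r]≈0 = trans (evaluate-cong (List.map (λ y → y) (fromRoots rs)) (sym x≈r)) Q≈0
      in ≈⇒¬# (begin
        Vec.foldr′ (λ s y → (r - s) ^ 2 * y) 1# rs ≈⟨ ∏[r-rᵢ]²≈fromRoots² r rs ⟩
        Q r * Q r                                  ≈⟨ *-congʳ Q[r]≈0 ⟩
        0# * Q r                                   ≈⟨ zeroˡ _ ⟩
        0#                                         ∎) (x*y#0⇒x#0 d#0)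
      where
      evaluate-cong : ∀ f {x y} → x ≈ y → evaluate f x ≈ evaluate f y
      evaluate-cong []      x≈y = refl
      evaluate-cong (a ∷ f) x≈y = +-congˡ (*-cong x≈y (evaluate-cong f x≈y))

  -- Both f and f′ are the leading coefficient times the values for the monic product; it is apart
  -- from 0 and cancels, which reduces to `fromRoots-simple`.
  discriminant#0⇒simple : ∀ {f D} → IsDiscriminant f D → D # 0# →
    ∀ x → evaluate f x ≈ 0# → ¬ slope f x ≈ 0#
  discriminant#0⇒simple {f} isD D#0 x fx≈0 f′x≈0 =
    fromRoots-simple roots (x*y#0⇒y#0 (#-congʳ value D#0)) x
      (x*y≈0∧y#0⇒x≈0 (trans (*-comm _ _) (begin
        coeff f m * ⟦ fromRoots roots ⟧ x                  ≈⟨ ⟦⟧-scale _ (fromRoots roots) x ⟨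
        ⟦ cP ⟧ x    ≈⟨ ⟦⟧-congₚ f cP factorisation x ⟨
        ⟦ f ⟧ x                                            ≡⟨ ≡.cong (λ g → evaluate g x) (map-id f) ⟩
        evaluate f x                                       ≈⟨ fx≈0 ⟩
        0#                                                 ∎)) (proj₁ degree))
      (x*y≈0∧y#0⇒x≈0 (trans (*-comm _ _) (begin
        coeff f m * ⟦ fromRoots roots ⟧′ x                 ≈⟨ ⟦⟧′-scale _ (fromRoots roots) x ⟨
        ⟦ cP ⟧′ x   ≈⟨ ⟦⟧′-congₚ f cP factorisation x ⟨
        ⟦ f ⟧′ x                                           ≡⟨ ≡.cong (λ g → slope g x) (map-id f) ⟩
        slope f x                                          ≈⟨ f′x≈0 ⟩
        0#                                                 ∎)) (proj₁ degree))
    where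
    open IsDiscriminant isD
    cP = List.map (coeff f m *_) (fromRoots roots)

-- Integer polynomials and the Euclidean step

module IntegerPolynomial where
  open UnivariateOver ℤ.+-*-rawRing public
  open Slope ℤ.+-*-commutativeRing public using (slope; derivative; evaluate-+; slope-+)

  id-homomorphic : IsRingHomomorphism ℤ.+-*-rawRing ℤ.+-*-rawRing (λ a → a)
  id-homomorphic = Identity.isRingHomomorphism ℤ.+-*-rawRing ≡.refl

  module IdEvaluation = Evaluation ℤ.+-*-commutativeRing ℤ.+-*-commutativeRing id-homomorphic

  -- Decidable equality in ℤ makes the leading coefficient computable despite trailing zeros. The
  -- strict bound on `length g` drives the termination of the Euclidean algorithm.
  trim : ∀ f → f ≈ₚ [] ⊎ ∃₂ λ g a → a ≢ 0ℤ × length g < length f × f ≈ₚ g ++ [ a ]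
  trim []      = inj₁ λ _ → ≡.refl
  trim (a ∷ f) with trim f | a ℤ.≟ 0ℤ
  ... | inj₂ (g , b , b≢0 , g<f , f≈g) | _       =
    inj₂ (a ∷ g , b , b≢0 , s≤s g<f , λ { zero → ≡.refl ; (suc i) → f≈g i })
  ... | inj₁ f≈0                       | yes a≡0 =
    inj₁ λ { zero → a≡0 ; (suc i) → f≈0 i }
  ... | inj₁ f≈0                       | no a≢0  =
    inj₂ ([] , a , a≢0 , z<s , λ { zero → ≡.refl ; (suc i) → f≈0 i })

  coeff-snoc : ∀ g a → coeff (g ++ [ a ]) (length g) ≡ a
  coeff-snoc []      a = ≡.refl
  coeff-snoc (b ∷ g) a = coeff-snoc g a

  coeff-beyond : ∀ f i → length f ≤ i → coeff f i ≡ 0ℤ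
  coeff-beyond []      i       _         = ≡.refl
  coeff-beyond (a ∷ f) (suc i) (s≤s f≤i) = coeff-beyond f i f≤i

  length-+ₚ : ∀ f g → length f ≡ length g → length (f +ₚ g) ≡ length f
  length-+ₚ []      []      _  = ≡.refl
  length-+ₚ (a ∷ f) (b ∷ g) eq = ≡.cong suc (length-+ₚ f g (ℕ.suc-injective eq))

  length-snoc : ∀ (f : List ℤ) a → length (f ++ [ a ]) ≡ suc (length f)
  length-snoc f a = ≡.trans (length-++ f) (ℕ.+-comm (length f) 1)

  -- For f = f₀ + a xⁱ and g = g₀ + b xʲ with i = k + j, the polynomial
  -- b f - a xᵏ g, in which the terms of degree i cancel.
  cancelLeading : List ℤ → ℤ → List ℤ → ℤ → ℕ → List ℤ
  cancelLeading f₀ a g₀ b k =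
    List.map (b ℤ.*_) f₀ +ₚ List.map (ℤ.- a ℤ.*_) (replicate k 0ℤ ++ g₀)

  length-cancelLeading : ∀ f₀ a g₀ b k → length f₀ ≡ k ℕ.+ length g₀ →
    length (cancelLeading f₀ a g₀ b k) ≡ length f₀
  length-cancelLeading f₀ a g₀ b k eq = ≡.trans (length-+ₚ (List.map (b ℤ.*_) f₀) _ (begin
    length (List.map (b ℤ.*_) f₀)                              ≡⟨ length-map _ f₀ ⟩
    length f₀                                                  ≡⟨ eq ⟩
    k ℕ.+ length g₀                                            ≡⟨ ≡.cong (ℕ._+ length g₀) (length-replicate k) ⟨
    length (replicate k 0ℤ) ℕ.+ length g₀                      ≡⟨ length-++ (replicate k 0ℤ) ⟨
    length (replicate k 0ℤ ++ g₀)                              ≡⟨ length-map _ (replicate k 0ℤ ++ g₀) ⟨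
    length (List.map (ℤ.- a ℤ.*_) (replicate k 0ℤ ++ g₀))      ∎)) (length-map _ f₀)
    where open ≡.≡-Reasoning

  -- The measure is the sum of the lengths. The new first list has lost the leading entry of `f`,
  -- and replacing `g` by its trimmed form does not lengthen it.
  cancelLeading-decreases : ∀ f₀ a g₀ b k {m n} → length f₀ ≡ k ℕ.+ length g₀ →
    length f₀ < m → length g₀ < n →
    length (cancelLeading f₀ a g₀ b k) ℕ.+ length (g₀ ++ [ b ]) < m ℕ.+ n
  cancelLeading-decreases f₀ a g₀ b k {m} {n} eq f₀<m g₀<n = begin-strict
    length (cancelLeading f₀ a g₀ b k) ℕ.+ length (g₀ ++ [ b ])
      ≡⟨ ≡.cong₂ ℕ._+_ (length-cancelLeading f₀ a g₀ b k eq) (length-snoc g₀ b) ⟩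
    length f₀ ℕ.+ suc (length g₀)
      <⟨ ℕ.+-mono-<-≤ f₀<m g₀<n ⟩
    m ℕ.+ n ∎
    where open ℕ.≤-Reasoning

  module _ {c ℓ} (S : CommutativeRing c ℓ) {φ : ℤ → CommutativeRing.Carrier S}
    (homomorphic : IsRingHomomorphism ℤ.+-*-rawRing (CommutativeRing.rawRing S) φ) where
    open CommutativeRing S
    open IsRingHomomorphism homomorphic
    open Evaluation ℤ.+-*-commutativeRing S homomorphic
    open import Algebra.Solver.Ring.NaturalCoefficients.Default commutativeSemiring
      using (solve; _:+_; _:*_; _:=_)
    open import Relation.Binary.Reasoning.Setoid setoid

    power-+ : ∀ x k m → power x (k ℕ.+ m) ≈ power x k * power x m
    power-+ x zero    m = sym (*-identityˡ _)
    power-+ x (suc k) m = trans (*-congˡ (power-+ x k m)) (sym (*-assoc _ _ _))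

    ⟦⟧-cancelLeading : ∀ f₀ a g₀ b k → length f₀ ≡ k ℕ.+ length g₀ → ∀ x →
      ⟦ cancelLeading f₀ a g₀ b k ⟧ x ≈
      φ b * ⟦ f₀ ++ [ a ] ⟧ x + φ (ℤ.- a) * power x k * ⟦ g₀ ++ [ b ] ⟧ x
    ⟦⟧-cancelLeading f₀ a g₀ b k eq x = begin
      ⟦ cancelLeading f₀ a g₀ b k ⟧ x
        ≈⟨ ⟦⟧-+ₚ (List.map (b ℤ.*_) f₀) _ x ⟩
      ⟦ List.map (b ℤ.*_) f₀ ⟧ x + ⟦ List.map (ℤ.- a ℤ.*_) (replicate k 0ℤ ++ g₀) ⟧ x
        ≈⟨ +-cong (⟦⟧-scale b f₀ x) (trans (⟦⟧-scale (ℤ.- a) (replicate k 0ℤ ++ g₀) x) (*-congˡ (⟦⟧-shift k g₀ x))) ⟩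
      φ b * y + φ (ℤ.- a) * (p * z)
        ≈⟨ +-identityʳ _ ⟨
      φ b * y + φ (ℤ.- a) * (p * z) + 0#
        -- The two cancelling leading terms, absent from the truncated lists, are put back as a
        -- zero. With a and -a as independent variables, what remains is a semiring identity.
        ≈⟨ +-congˡ (trans (*-congˡ φa-φa≈0) (zeroʳ _)) ⟨
      φ b * y + φ (ℤ.- a) * (p * z) + φ b * (p * q) * (φ a + φ (ℤ.- a))
        ≈⟨ solve 7 (λ y z p q a -a b →
             b :* y :+ -a :* (p :* z) :+ b :* (p :* q) :* (a :+ -a) :=
             b :* (y :+ p :* q :* a) :+ -a :* p :* (z :+ q :* b)) refl y z p q (φ a) (φ (ℤ.- a)) (φ b) ⟩
      φ b * (y + p * q * φ a) + φ (ℤ.- a) * p * (z + q * φ b)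
        ≈⟨ +-cong (*-congˡ f₀xⁱ) (*-congˡ (sym (⟦⟧-snoc g₀ b x))) ⟩
      φ b * ⟦ f₀ ++ [ a ] ⟧ x + φ (ℤ.- a) * p * ⟦ g₀ ++ [ b ] ⟧ x ∎
      where
      y = ⟦ f₀ ⟧ x
      z = ⟦ g₀ ⟧ x
      p = power x k
      q = power x (length g₀)

      φa-φa≈0 : φ a + φ (ℤ.- a) ≈ 0#
      φa-φa≈0 = trans (+-congˡ (-‿homo a)) (-‿inverseʳ (φ a))

      f₀xⁱ : y + p * q * φ a ≈ ⟦ f₀ ++ [ a ] ⟧ x
      f₀xⁱ = begin
        y + p * q * φ a                        ≈⟨ +-congˡ (*-congʳ (power-+ x k (length g₀))) ⟨
        y + power x (k ℕ.+ length g₀) * φ a    ≡⟨ ≡.cong (λ n → y + power x n * φ a) (≡.sym eq) ⟩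
        y + power x (length f₀) * φ a          ≈⟨ ⟦⟧-snoc f₀ a x ⟨
        ⟦ f₀ ++ [ a ] ⟧ x                      ∎

-- Common root or non-zero constant: the Euclidean dichotomy

module CommonRoots {c ℓ₁ ℓ₂} (H : HeytingField c ℓ₁ ℓ₂)
  (closed : OverField.IsAlgebraicallyClosed H)
  {φ : ℤ → HeytingField.Carrier H}
  (homomorphic : IsRingHomomorphism ℤ.+-*-rawRing
    (CommutativeRing.rawRing (HeytingFieldProperties.commutativeRing H)) φ)
  (φ#0 : ∀ {a} → a ≢ 0ℤ → HeytingField._#_ H (φ a) (HeytingField.0# H))
  where
  open IntegerPolynomial
  open HeytingField H
  open HeytingFieldProperties H
  open OverField H using (HasDegree) renaming (coeff to coeffₖ)
  open Evaluation ℤ.+-*-commutativeRing commutativeRing homomorphic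
  open IsRingHomomorphism homomorphic using (0#-homo)
  module Id = IdEvaluation
  open import Relation.Binary.Reasoning.Setoid setoid

  CommonRoot : List ℤ → List ℤ → Set _
  CommonRoot f g = ∃ λ x → ⟦ f ⟧ x ≈ 0# × ⟦ g ⟧ x ≈ 0#

  -- Instead of Δ = u f + v g, only the consequence for common divisors of values.
  Coprimeₚ : List ℤ → List ℤ → Set
  Coprimeₚ f g = ∃ λ Δ → Δ ≢ 0ℤ × ∀ x d → (d ∣ Id.⟦ f ⟧ x) → (d ∣ Id.⟦ g ⟧ x) → d ∣ Δ

  Dichotomy : List ℤ → List ℤ → Set _
  Dichotomy f g = CommonRoot f g ⊎ Coprimeₚ f g

  swapDichotomy : ∀ f g → Dichotomy f g → Dichotomy g f
  swapDichotomy f g = Sum.map (map₂ swap) λ (Δ , Δ≢0 , dvd) → Δ , Δ≢0 , λ x d p q → dvd x d q p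

  -- The algorithm stops here, with greatest common divisor `g`. If `g` is the constant `b`, then Δ
  -- = b; otherwise algebraic closedness gives a root of `g`, which is also one of f = 0.
  zeroOrUnit-dichotomy : ∀ f g g₀ b → f ≈ₚ [] → b ≢ 0ℤ → g ≈ₚ g₀ ++ [ b ] → Dichotomy f g
  zeroOrUnit-dichotomy f g [] b f≈0 b≢0 g≈b = inj₂ (b , b≢0 , λ x d _ d∣g →
    ≡.subst (d ∣_) (≡.trans (Id.⟦⟧-congₚ g [ b ] g≈b x)
      (≡.trans (≡.cong (λ c → b ℤ.+ c) (ℤ.*-zeroʳ x)) (ℤ.+-identityʳ b))) d∣g)
  zeroOrUnit-dichotomy f g g₀@(_ ∷ g₁) b f≈0 b≢0 g≈ =
    let x , gx≈0 = closed (List.map φ (g₀ ++ [ b ])) (length g₀) (s≤s z≤n) hasDegree in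
    inj₁ (x , ⟦⟧-zero f f≈0 x , trans (⟦⟧-congₚ g (g₀ ++ [ b ]) g≈ x) gx≈0)
    where
    hasDegree : HasDegree (List.map φ (g₀ ++ [ b ])) (length g₀)
    hasDegree =
      #-congʳ (sym (trans (coeff-map (g₀ ++ [ b ]) (length g₀)) (reflexive (≡.cong φ (coeff-snoc g₀ b))))) (φ#0 b≢0) ,
      λ i g₀<i → trans (coeff-map (g₀ ++ [ b ]) i)
        (trans (reflexive (≡.cong φ (coeff-beyond (g₀ ++ [ b ]) i (≡.subst (_≤ i) (≡.sym (length-snoc g₀ b)) g₀<i)))) 0#-homo)

  -- At a common root of the remainder and `g`, the product φ(b) f(x) vanishes and φ(b) cancels. A
  -- common divisor of f(x) and g(x) divides the remainder's value, an integer combination of the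
  -- two, so the same Δ serves.
  cancelLeading-dichotomy : ∀ f g f₀ a g₀ b k → b ≢ 0ℤ → f ≈ₚ f₀ ++ [ a ] → g ≈ₚ g₀ ++ [ b ] →
    length f₀ ≡ k ℕ.+ length g₀ → Dichotomy (cancelLeading f₀ a g₀ b k) (g₀ ++ [ b ]) → Dichotomy f g
  cancelLeading-dichotomy f g f₀ a g₀ b k b≢0 f≈ g≈ eq = Sum.map
    (λ (x , hx≈0 , gx≈0) → x ,
      trans (⟦⟧-congₚ f (f₀ ++ [ a ]) f≈ x) (x*y≈0∧y#0⇒x≈0 (begin
        ⟦ f₀ ++ [ a ] ⟧ x * φ b
          ≈⟨ *-comm _ _ ⟩
        φ b * ⟦ f₀ ++ [ a ] ⟧ x
          ≈⟨ +-identityʳ _ ⟨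
        φ b * ⟦ f₀ ++ [ a ] ⟧ x + 0#
          ≈⟨ +-congˡ (trans (*-congˡ gx≈0) (zeroʳ _)) ⟨
        φ b * ⟦ f₀ ++ [ a ] ⟧ x + φ (ℤ.- a) * power x k * ⟦ g₀ ++ [ b ] ⟧ x
          ≈⟨ ⟦⟧-cancelLeading commutativeRing homomorphic f₀ a g₀ b k eq x ⟨
        ⟦ cancelLeading f₀ a g₀ b k ⟧ x
          ≈⟨ hx≈0 ⟩
        0# ∎) (φ#0 b≢0)) ,
      trans (⟦⟧-congₚ g (g₀ ++ [ b ]) g≈ x) gx≈0)
    (map₂ λ (Δ≢0 , dvd) → Δ≢0 , λ x d d∣f d∣g →
      let d∣g′ = ≡.subst (d ∣_) (Id.⟦⟧-congₚ g (g₀ ++ [ b ]) g≈ x) d∣g in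
      dvd x d
        (≡.subst (d ∣_) (≡.sym (⟦⟧-cancelLeading ℤ.+-*-commutativeRing id-homomorphic f₀ a g₀ b k eq x))
          (∣m∣n⇒∣m+n (∣n⇒∣m*n b (≡.subst (d ∣_) (Id.⟦⟧-congₚ f (f₀ ++ [ a ]) f≈ x) d∣f))
            (∣n⇒∣m*n (ℤ.- a ℤ.* Id.power x k) d∣g′)))
        d∣g′)

  -- The subtractive Euclidean algorithm.
  dichotomy-bounded : ∀ n f g → length f ℕ.+ length g < n → Dichotomy f g
  dichotomy-bounded (suc n) f g (s≤s f+g≤n) with trim f | trim g
  ... | inj₁ f≈0 | inj₁ g≈0 = inj₁ (0# , ⟦⟧-zero f f≈0 0# , ⟦⟧-zero g g≈0 0#)
  ... | inj₁ f≈0 | inj₂ (g₀ , b , b≢0 , _ , g≈) = zeroOrUnit-dichotomy f g g₀ b f≈0 b≢0 g≈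
  ... | inj₂ (f₀ , a , a≢0 , _ , f≈) | inj₁ g≈0 =
    swapDichotomy g f (zeroOrUnit-dichotomy g f f₀ a g≈0 a≢0 f≈)
  ... | inj₂ (f₀ , a , a≢0 , f₀<f , f≈) | inj₂ (g₀ , b , b≢0 , g₀<g , g≈)
    with ℕ.≤-total (length g₀) (length f₀)
  ...   | inj₁ g₀≤f₀ = cancelLeading-dichotomy f g f₀ a g₀ b _ b≢0 f≈ g≈ eq
    (dichotomy-bounded n (cancelLeading f₀ a g₀ b _) (g₀ ++ [ b ])
      (ℕ.<-≤-trans (cancelLeading-decreases f₀ a g₀ b _ eq f₀<f g₀<g) f+g≤n))
    where eq = ≡.sym (ℕ.m∸n+n≡m g₀≤f₀)
  ...   | inj₂ f₀≤g₀ = swapDichotomy g f (cancelLeading-dichotomy g f g₀ b f₀ a _ a≢0 g≈ f≈ eq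
    (dichotomy-bounded n (cancelLeading g₀ b f₀ a _) (f₀ ++ [ a ])
      (ℕ.<-≤-trans (cancelLeading-decreases g₀ b f₀ a _ eq g₀<g f₀<f)
        (ℕ.≤-trans (ℕ.≤-reflexive (ℕ.+-comm (length g) (length f))) f+g≤n))))
    where eq = ≡.sym (ℕ.m∸n+n≡m f₀≤g₀)

  dichotomy : ∀ f g → Dichotomy f g
  dichotomy f g = dichotomy-bounded _ f g (ℕ.n<1+n _)

open IntegerPolynomial
open import Data.Nat.Base using (_^_)

-- Large prime divisors of polynomial values

prime-divisor : ∀ n → 1 < n → ∃[ p ] Prime p × p ℕ.∣ n
prime-divisor n@(suc _) 1<n with factorise n
... | record { factors = []     ; isFactorisation = n≡1 }  = contradiction n≡1 (ℕ.>⇒≢ 1<n)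
... | record { factors = p ∷ ps ; isFactorisation = n≡pm ; factorsPrime = p-prime ∷ _ } =
  p , p-prime , ≡.subst (p ℕ.∣_) (≡.sym n≡pm) (ℕ.m∣m*n _)

m∣n! : ∀ {m n} → .{{NonZero m}} → m ≤ n → m ℕ.∣ n !
m∣n! {suc m} m≤n = ℕ.∣-trans (ℕ.m∣m*n (m !)) (ℕ.m≤n⇒m!∣n! m≤n)

-- Euclid's argument: a prime up to `N` divides N!, hence would divide 1.
large-prime-divisor : ∀ N c → 1 < ∣ 1ℤ ℤ.+ + (N !) ℤ.* c ∣ →
  ∃[ p ] N < p × Prime p × + p ∣ 1ℤ ℤ.+ + (N !) ℤ.* c
large-prime-divisor N c 1<u with prime-divisor _ 1<u
... | p , p-prime , p∣u = p , ℕ.≰⇒> p≰N , p-prime , ∣ᵤ⇒∣ p∣u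
  where
  p≰N : ¬ p ≤ N
  p≰N p≤N = ¬prime[1] (≡.subst Prime (ℕ.∣1⇒≡1 (∣⇒∣ᵤ (∣m+n∣n⇒∣m {+ p} {1ℤ} (∣ᵤ⇒∣ p∣u)
    (∣m⇒∣m*n c (∣ᵤ⇒∣ {+ p} {+ (N !)} (m∣n! {{prime⇒nonZero p-prime}} p≤N)))))) p-prime)

≈[]? : ∀ f → Dec (f ≈ₚ [])
≈[]? f with trim f
... | inj₁ f≈0                     = yes f≈0
... | inj₂ (g , a , a≢0 , _ , f≈g) = no λ f≈0 →
  a≢0 (≡.trans (≡.sym (coeff-snoc g a)) (≡.trans (≡.sym (f≈g (length g))) (f≈0 (length g))))

evaluate-zero : ∀ f → f ≈ₚ [] → ∀ x → evaluate f x ≡ 0ℤ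
evaluate-zero f f≈0 x =
  ≡.subst (λ g → evaluate g x ≡ 0ℤ) (map-id f) (IdEvaluation.⟦⟧-zero f f≈0 x)

-- Induction on f = a + x g: if g(x) ≠ 0 and ∣x∣ > ∣a∣, then ∣x g(x)∣ ≥ ∣x∣ > ∣a∣, so no
-- cancellation is possible. If g = 0, then f is a non-zero constant.
roots-bounded : ∀ f → ¬ f ≈ₚ [] → ∃[ B ] ∀ x → B ≤ ∣ x ∣ → evaluate f x ≢ 0ℤ
roots-bounded []      f≉0 = contradiction (λ _ → ≡.refl) f≉0
roots-bounded (a ∷ f) f≉0 with ≈[]? f
... | yes f≈0 = 0 , λ x _ fx≡0 → f≉0 λ
  { zero    → ≡.trans (≡.sym (≡.trans (≡.cong (λ y → a ℤ.+ x ℤ.* y) (evaluate-zero f f≈0 x))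
                (≡.trans (≡.cong (λ y → a ℤ.+ y) (ℤ.*-zeroʳ x)) (ℤ.+-identityʳ a)))) fx≡0
  ; (suc i) → f≈0 i
  }
... | no f≉0′ = let B , bounded = roots-bounded f f≉0′ in
  B ℕ.⊔ suc ∣ a ∣ , λ x B≤x fx≡0 →
    let instance
          fx≢0 : NonZero ∣ evaluate f x ∣
          fx≢0 = ℕ.≢-nonZero λ ∣fx∣≡0 → bounded x (ℕ.≤-trans (ℕ.m≤m⊔n B _) B≤x) (ℤ.∣i∣≡0⇒i≡0 ∣fx∣≡0)
    in ℕ.<-irrefl ≡.refl (begin-strict
      ∣ a ∣                         <⟨ ℕ.≤-trans (ℕ.m≤n⊔m B _) B≤x ⟩
      ∣ x ∣                         ≤⟨ ℕ.m≤m*n ∣ x ∣ ∣ evaluate f x ∣ ⟩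
      ∣ x ∣ ℕ.* ∣ evaluate f x ∣    ≡⟨ ℤ.abs-* x (evaluate f x) ⟨
      ∣ x ℤ.* evaluate f x ∣        ≡⟨ ℤ.∣-i∣≡∣i∣ (x ℤ.* evaluate f x) ⟨
      ∣ ℤ.- (x ℤ.* evaluate f x) ∣  ≡⟨ ≡.cong ∣_∣ (a+b≡0⇒a≡-b a (x ℤ.* evaluate f x) fx≡0) ⟨
      ∣ a ∣                         ∎)
  where
  open ℕ.≤-Reasoning
  a+b≡0⇒a≡-b : ∀ a b → a ℤ.+ b ≡ 0ℤ → a ≡ ℤ.- b
  a+b≡0⇒a≡-b a b eq = ≡.trans (lemma a b) (≡.trans (≡.cong (ℤ._- b) eq) (ℤ.+-identityˡ _))
    where
    lemma : ∀ a b → a ≡ a ℤ.+ b ℤ.- b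
    lemma = solve-∀

1<∣1+i∣ : ∀ i → 2 < ∣ i ∣ → 1 < ∣ 1ℤ ℤ.+ i ∣
1<∣1+i∣ i 2<i = ℕ.s≤s⁻¹ (begin-strict
  2                              <⟨ 2<i ⟩
  ∣ i ∣                          ≡⟨ ≡.cong ∣_∣ (lemma i) ⟩
  ∣ (1ℤ ℤ.+ i) ℤ.- 1ℤ ∣          ≤⟨ ℤ.∣i-j∣≤∣i∣+∣j∣ (1ℤ ℤ.+ i) 1ℤ ⟩
  ∣ 1ℤ ℤ.+ i ∣ ℕ.+ 1             ≡⟨ ℕ.+-comm _ 1 ⟩
  suc ∣ 1ℤ ℤ.+ i ∣               ∎)
  where
  open ℕ.≤-Reasoning
  lemma : ∀ i → i ≡ (1ℤ ℤ.+ i) ℤ.- 1ℤ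
  lemma = solve-∀

-- Schur: if a ≠ 0, the quotient f(a t) / a = 1 + t g(a t) is prime to N! when
-- N! divides t, and it is not a unit when t is large.
value-with-large-prime-divisor : ∀ f → ¬ List.drop 1 f ≈ₚ [] →
  ∀ N → ∃₂ λ p x → N < p × Prime p × + p ∣ evaluate f x
value-with-large-prime-divisor []      g≉0 N = contradiction (λ _ → ≡.refl) g≉0
value-with-large-prime-divisor (a ∷ g) g≉0 N with a ℤ.≟ 0ℤ
-- Here f(0) = 0 is divisible by every prime, so any prime beyond `N` will do; the factor 3 only
-- keeps 1 + 3 N! away from units.
... | yes ≡.refl =
  let p , N<p , p-prime , _ = large-prime-divisor N (+ 3)
        (1<∣1+i∣ (+ (N !) ℤ.* + 3) (≡.subst (2 <_) (≡.sym (ℤ.abs-* (+ (N !)) (+ 3))) (ℕ.m≤n*m 3 (N !) {{N!≢0}})))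
  in p , 0ℤ , N<p , p-prime ,
       ≡.subst (+ p ∣_) (≡.sym (≡.trans (ℤ.+-identityˡ _) (ℤ.*-zeroˡ (evaluate g 0ℤ)))) (∣ᵤ⇒∣ (p ℕ.∣0))
  where
  N!≢0 : NonZero (N !)
  N!≢0 = ℕ._!≢0 N
... | no a≢0 =
  let p , N<p , p-prime , p∣u = large-prime-divisor N c (1<∣1+i∣ (+ (N !) ℤ.* c) 2<N!c)
  in p , x , N<p , p-prime , ≡.subst (+ p ∣_) (rearrange a (+ (N !)) (+ s) y) (∣n⇒∣m*n a p∣u)
  where
  instance
    N!≢0 : NonZero (N !)
    N!≢0 = ℕ._!≢0 N
    ∣a∣≢0 : NonZero ∣ a ∣
    ∣a∣≢0 = ℕ.≢-nonZero λ ∣a∣≡0 → a≢0 (ℤ.∣i∣≡0⇒i≡0 ∣a∣≡0)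
  B = proj₁ (roots-bounded g g≉0)
  -- The summand `B` makes ∣x∣ large enough for g(x) ≠ 0, and 3 makes ∣N! s g(x)∣ exceed 2, so that
  -- adding 1 cannot give a unit.
  s = B ℕ.+ 3
  x = a ℤ.* (+ (N !) ℤ.* + s)
  y = evaluate g x
  c = + s ℤ.* y

  open ℕ.≤-Reasoning

  B≤∣x∣ : B ≤ ∣ x ∣
  B≤∣x∣ = begin
    B                               ≤⟨ ℕ.m≤m+n B 3 ⟩
    s                               ≤⟨ ℕ.m≤n*m s (N !) ⟩
    N ! ℕ.* s                       ≤⟨ ℕ.m≤n*m (N ! ℕ.* s) ∣ a ∣ ⟩
    ∣ a ∣ ℕ.* (N ! ℕ.* s)           ≡⟨ ≡.cong (∣ a ∣ ℕ.*_) (ℤ.abs-* (+ (N !)) (+ s)) ⟨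
    ∣ a ∣ ℕ.* ∣ + (N !) ℤ.* + s ∣   ≡⟨ ℤ.abs-* a (+ (N !) ℤ.* + s) ⟨
    ∣ x ∣                           ∎

  instance
    ∣y∣≢0 : NonZero ∣ y ∣
    ∣y∣≢0 = ℕ.≢-nonZero λ ∣y∣≡0 → proj₂ (roots-bounded g g≉0) x B≤∣x∣ (ℤ.∣i∣≡0⇒i≡0 ∣y∣≡0)

  2<N!c : 2 < ∣ + (N !) ℤ.* c ∣
  2<N!c = begin-strict
    2                            <⟨ ℕ.m≤n+m 3 B ⟩
    s                            ≤⟨ ℕ.m≤m*n s ∣ y ∣ ⟩
    s ℕ.* ∣ y ∣                  ≡⟨ ℤ.abs-* (+ s) y ⟨
    ∣ c ∣                        ≤⟨ ℕ.m≤n*m ∣ c ∣ (N !) ⟩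
    N ! ℕ.* ∣ c ∣                ≡⟨ ℤ.abs-* (+ (N !)) c ⟨
    ∣ + (N !) ℤ.* c ∣            ∎

  rearrange : ∀ a n s y → a ℤ.* (1ℤ ℤ.+ n ℤ.* (s ℤ.* y)) ≡ a ℤ.+ a ℤ.* (n ℤ.* s) ℤ.* y
  rearrange = solve-∀

-- Hensel lifting

module _ {p} (p-prime : Prime p) where

  prime∤⇒coprime : ∀ {n} → ¬ p ℕ.∣ n → Coprime p n
  prime∤⇒coprime p∤n (d∣p , d∣n) with prime⇒irreducible p-prime d∣p
  ... | inj₁ d≡1    = d≡1
  ... | inj₂ ≡.refl = contradiction d∣n p∤n

  -- Bézout's identity for `p` and `∣ b ∣` over ℕ has two shapes, and σ restores the sign of `b`.
  -- The negative inverse is what Newton's correction -f / f′ calls for.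
  negative-inverse : ∀ {b} → ¬ + p ∣ b → ∃[ t ] + p ∣ 1ℤ ℤ.+ t ℤ.* b
  negative-inverse {b} p∤b with coprime-Bézout (prime∤⇒coprime λ p∣∣b∣ → p∤b (∣ᵤ⇒∣ p∣∣b∣))
                               | ∣b∣≡σb b
    where
    ∣b∣≡σb : ∀ b → ∃[ σ ] + ∣ b ∣ ≡ σ ℤ.* b
    ∣b∣≡σb b with ℤ.+∣i∣≡i⊎+∣i∣≡-i b
    ... | inj₁ eq = 1ℤ , ≡.trans eq (≡.sym (ℤ.*-identityˡ b))
    ... | inj₂ eq = ℤ.- 1ℤ , ≡.trans eq (≡.sym (ℤ.-1*i≡-i b))
  ... | ℕ.Bézout.+- x y 1+yb≡xp | σ , ∣b∣≡σb = + y ℤ.* σ , divides (+ x) (begin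
    1ℤ ℤ.+ + y ℤ.* σ ℤ.* b     ≡⟨ ≡.cong (λ z → 1ℤ ℤ.+ z) (≡.trans (ℤ.*-assoc (+ y) σ b) (≡.cong (+ y ℤ.*_) (≡.sym ∣b∣≡σb))) ⟩
    1ℤ ℤ.+ + y ℤ.* + ∣ b ∣     ≡⟨ ≡.cong (λ z → 1ℤ ℤ.+ z) (ℤ.pos-* y ∣ b ∣) ⟨
    + (1 ℕ.+ y ℕ.* ∣ b ∣)      ≡⟨ ≡.cong +_ 1+yb≡xp ⟩
    + (x ℕ.* p)                ≡⟨ ℤ.pos-* x p ⟩
    + x ℤ.* + p                ∎)
    where open ≡.≡-Reasoning
  ... | ℕ.Bézout.-+ x y 1+xp≡yb | σ , ∣b∣≡σb = ℤ.- (+ y ℤ.* σ) , divides (ℤ.- + x) (begin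
    1ℤ ℤ.+ ℤ.- (+ y ℤ.* σ) ℤ.* b     ≡⟨ lemma₁ (+ y) σ b ⟩
    1ℤ ℤ.- + y ℤ.* (σ ℤ.* b)         ≡⟨ ≡.cong (λ z → 1ℤ ℤ.- + y ℤ.* z) ∣b∣≡σb ⟨
    1ℤ ℤ.- + y ℤ.* + ∣ b ∣           ≡⟨ ≡.cong (λ z → 1ℤ ℤ.- z) (ℤ.pos-* y ∣ b ∣) ⟨
    1ℤ ℤ.- + (y ℕ.* ∣ b ∣)           ≡⟨ ≡.cong (λ z → 1ℤ ℤ.- + z) 1+xp≡yb ⟨
    1ℤ ℤ.- (1ℤ ℤ.+ + (x ℕ.* p))      ≡⟨ ≡.cong (λ z → 1ℤ ℤ.- (1ℤ ℤ.+ z)) (ℤ.pos-* x p) ⟩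
    1ℤ ℤ.- (1ℤ ℤ.+ + x ℤ.* + p)      ≡⟨ lemma₂ (+ x) (+ p) ⟩
    ℤ.- + x ℤ.* + p                  ∎)
    where
    open ≡.≡-Reasoning
    lemma₁ : ∀ y σ b → 1ℤ ℤ.+ ℤ.- (y ℤ.* σ) ℤ.* b ≡ 1ℤ ℤ.- y ℤ.* (σ ℤ.* b)
    lemma₁ = solve-∀
    lemma₂ : ∀ x p → 1ℤ ℤ.- (1ℤ ℤ.+ x ℤ.* p) ≡ ℤ.- x ℤ.* p
    lemma₂ = solve-∀

  -- Newton's iteration, stopped at finite precision so that it stays in ℤ. Each step gains one
  -- factor p, and the derivative keeps its residue modulo p, so it stays prime to p.
  hensel : ∀ f {x₀} → (+ p ∣ evaluate f x₀) → ¬ (+ p ∣ slope f x₀) → ∀ {z} → + p ∣ z →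
    ∀ k → ∃[ x ] (+ (p ^ suc k) ∣ evaluate f x ℤ.- z) × ¬ (+ p ∣ slope f x)
  hensel f {x₀} p∣fx₀ p∤f′x₀ {z} p∣z zero =
    -- At precision p both f(x₀) and z are 0, which is where divisibility of z is needed.
    x₀ , ≡.subst (λ q → + q ∣ evaluate f x₀ ℤ.- z) (≡.sym (ℕ.*-identityʳ p)) (∣m∣n⇒∣m-n p∣fx₀ p∣z) , p∤f′x₀
  hensel f p∣fx₀ p∤f′x₀ {z} p∣z (suc k) with hensel f p∣fx₀ p∤f′x₀ p∣z k
  ... | x , divides c fx-z≡cP , p∤f′x with negative-inverse p∤f′x
  ...   | t , p∣1+tf′x = x ℤ.+ h , pP∣f[x+h]-z , p∤f′[x+h]
    where
    P = + (p ^ suc k)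
    f′x = slope f x
    -- Newton's step: t is -1 / f′(x) modulo p.
    h = P ℤ.* (c ℤ.* t)
    q = proj₁ (evaluate-+ f x h)
    r = proj₁ (slope-+ f x h)

    p∣P : + p ∣ P
    p∣P = ∣ᵤ⇒∣ (ℕ.m∣m*n (p ^ k))

    p∣h : + p ∣ h
    p∣h = ∣m⇒∣m*n (c ℤ.* t) p∣P

    p∤f′[x+h] : ¬ + p ∣ slope f (x ℤ.+ h)
    p∤f′[x+h] p∣f′ = p∤f′x (∣m+n∣n⇒∣m {+ p} {f′x} (≡.subst (+ p ∣_) (proj₂ (slope-+ f x h)) p∣f′) (∣m⇒∣m*n r p∣h))

    -- With P factored out of f(x + h) - z, the first summand is divisible by p by the choice of t,
    -- and the second because p divides h.
    rearrange : ∀ y z c P t s q → y ℤ.- z ≡ c ℤ.* P →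
      y ℤ.+ P ℤ.* (c ℤ.* t) ℤ.* (s ℤ.+ P ℤ.* (c ℤ.* t) ℤ.* q) ℤ.- z ≡
      (c ℤ.* (1ℤ ℤ.+ t ℤ.* s) ℤ.+ P ℤ.* (c ℤ.* t) ℤ.* (c ℤ.* t ℤ.* q)) ℤ.* P
    rearrange y z c P t s q eq =
      ≡.trans (lemma₁ y z (P ℤ.* (c ℤ.* t) ℤ.* (s ℤ.+ P ℤ.* (c ℤ.* t) ℤ.* q)))
        (≡.trans (≡.cong (λ i → i ℤ.+ P ℤ.* (c ℤ.* t) ℤ.* (s ℤ.+ P ℤ.* (c ℤ.* t) ℤ.* q)) eq) (lemma₂ c P t s q))
      where
      lemma₁ : ∀ y z w → y ℤ.+ w ℤ.- z ≡ y ℤ.- z ℤ.+ w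
      lemma₁ = solve-∀
      lemma₂ : ∀ c P t s q →
        c ℤ.* P ℤ.+ P ℤ.* (c ℤ.* t) ℤ.* (s ℤ.+ P ℤ.* (c ℤ.* t) ℤ.* q) ≡
        (c ℤ.* (1ℤ ℤ.+ t ℤ.* s) ℤ.+ P ℤ.* (c ℤ.* t) ℤ.* (c ℤ.* t ℤ.* q)) ℤ.* P
      lemma₂ = solve-∀

    pP∣f[x+h]-z : + (p ^ suc (suc k)) ∣ evaluate f (x ℤ.+ h) ℤ.- z
    pP∣f[x+h]-z = ≡.subst₂ _∣_ (≡.sym (ℤ.pos-* p (p ^ suc k)))
      (≡.sym (≡.trans (≡.cong (ℤ._- z) (proj₂ (evaluate-+ f x h)))
        (rearrange (evaluate f x) z c P t f′x q fx-z≡cP)))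
      (*-monoˡ-∣ P (∣m∣n⇒∣m+n (∣n⇒∣m*n c p∣1+tf′x) (∣m⇒∣m*n (c ℤ.* t ℤ.* q) p∣h)))

-- The integers inside ℚ

toℚᵘ-fromℤ : ∀ z → toℚᵘ (fromℤ z) ≃ mkℚᵘ z 0
toℚᵘ-fromℤ z = ℚ.toℚᵘ-fromℚᵘ (mkℚᵘ z 0)

fromℤ-+ : ∀ a b → fromℤ (a ℤ.+ b) ≡ fromℤ a ℚ.+ fromℤ b
fromℤ-+ a b = ℚ.toℚᵘ-injective (begin
  toℚᵘ (fromℤ (a ℤ.+ b))                  ≈⟨ toℚᵘ-fromℤ (a ℤ.+ b) ⟩
  mkℚᵘ (a ℤ.+ b) 0                        ≈⟨ *≡* (lemma a b) ⟩
  mkℚᵘ a 0 ℚᵘ.+ mkℚᵘ b 0                  ≈⟨ ℚᵘ.+-cong (toℚᵘ-fromℤ a) (toℚᵘ-fromℤ b) ⟨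
  toℚᵘ (fromℤ a) ℚᵘ.+ toℚᵘ (fromℤ b)      ≈⟨ ℚ.toℚᵘ-homo-+ (fromℤ a) (fromℤ b) ⟨
  toℚᵘ (fromℤ a ℚ.+ fromℤ b)              ∎)
  where
  open ℚᵘ.≃-Reasoning
  lemma : ∀ a b → (a ℤ.+ b) ℤ.* 1ℤ ≡ (a ℤ.* 1ℤ ℤ.+ b ℤ.* 1ℤ) ℤ.* 1ℤ
  lemma = solve-∀

fromℤ-* : ∀ a b → fromℤ (a ℤ.* b) ≡ fromℤ a ℚ.* fromℤ b
fromℤ-* a b = ℚ.toℚᵘ-injective (begin
  toℚᵘ (fromℤ (a ℤ.* b))                  ≈⟨ toℚᵘ-fromℤ (a ℤ.* b) ⟩
  mkℚᵘ a 0 ℚᵘ.* mkℚᵘ b 0                  ≈⟨ ℚᵘ.*-cong (toℚᵘ-fromℤ a) (toℚᵘ-fromℤ b) ⟨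
  toℚᵘ (fromℤ a) ℚᵘ.* toℚᵘ (fromℤ b)      ≈⟨ ℚ.toℚᵘ-homo-* (fromℤ a) (fromℤ b) ⟨
  toℚᵘ (fromℤ a ℚ.* fromℤ b)              ∎)
  where open ℚᵘ.≃-Reasoning

fromℤ-neg : ∀ a → fromℤ (ℤ.- a) ≡ ℚ.- fromℤ a
fromℤ-neg a = ℚ.toℚᵘ-injective (begin
  toℚᵘ (fromℤ (ℤ.- a))       ≈⟨ toℚᵘ-fromℤ (ℤ.- a) ⟩
  ℚᵘ.- mkℚᵘ a 0              ≈⟨ ℚᵘ.-‿cong (toℚᵘ-fromℤ a) ⟨
  ℚᵘ.- toℚᵘ (fromℤ a)        ≈⟨ ℚ.toℚᵘ-homo‿- (fromℤ a) ⟨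
  toℚᵘ (ℚ.- fromℤ a)         ∎)
  where open ℚᵘ.≃-Reasoning

fromℤ-isRingHomomorphism : IsRingHomomorphism ℤ.+-*-rawRing ℚ.+-*-rawRing fromℤ
fromℤ-isRingHomomorphism = record
  { isSemiringHomomorphism = record
    { isNearSemiringHomomorphism = record
      { +-isMonoidHomomorphism = record
        { isMagmaHomomorphism = record
          { isRelHomomorphism = record { cong = ≡.cong fromℤ }
          ; homo = fromℤ-+
          }
        ; ε-homo = ≡.refl
        }
      ; *-homo = fromℤ-*
      }
    ; 1#-homo = ≡.refl
    }
  ; -‿homo = fromℤ-neg
  }

fromℤ-injective : ∀ {a b} → fromℤ a ≡ fromℤ b → a ≡ b
fromℤ-injective {a} {b} eq
  with ℚᵘ.≃-trans (ℚᵘ.≃-sym (toℚᵘ-fromℤ a)) (ℚᵘ.≃-trans (ℚᵘ.≃-reflexive (≡.cong toℚᵘ eq)) (toℚᵘ-fromℤ b))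
... | *≡* a1≡b1 = ℤ.*-cancelʳ-≡ a b 1ℤ a1≡b1

fromℤ-invertible : ∀ {a} → a ≢ 0ℤ → ∃[ r ] r ℚ.* fromℤ a ≡ 1ℚ
fromℤ-invertible {a} a≢0 = ℚ.1/ fromℤ a , ℚ.*-inverseˡ (fromℤ a)
  where
  instance
    fromℤ≢0 : ℚ.NonZero (fromℤ a)
    fromℤ≢0 = ℚ.≢-nonZero λ eq → a≢0 (fromℤ-injective eq)

-- This transports divisibility from a convenient fraction n / a to the lowest terms of `w`, in
-- which `NormBound` is stated.
↥*≡*↧ : ∀ {w a n} → w ℚ.* fromℤ a ≡ fromℤ n → ↥ w ℤ.* a ≡ n ℤ.* ↧ w
↥*≡*↧ {w@record{}} {a} {n} eq with begin
  toℚᵘ w ℚᵘ.* mkℚᵘ a 0         ≈⟨ ℚᵘ.*-congˡ {toℚᵘ w} (toℚᵘ-fromℤ a) ⟨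
  toℚᵘ w ℚᵘ.* toℚᵘ (fromℤ a)   ≈⟨ ℚ.toℚᵘ-homo-* w (fromℤ a) ⟨
  toℚᵘ (w ℚ.* fromℤ a)         ≈⟨ ℚᵘ.≃-reflexive (≡.cong toℚᵘ eq) ⟩
  toℚᵘ (fromℤ n)               ≈⟨ toℚᵘ-fromℤ n ⟩
  mkℚᵘ n 0                     ∎
  where open ℚᵘ.≃-Reasoning
... | *≡* eq′ = begin
  ↥ w ℤ.* a                      ≡⟨ ℤ.*-identityʳ _ ⟨
  ↥ w ℤ.* a ℤ.* 1ℤ               ≡⟨ eq′ ⟩
  n ℤ.* + (↧ₙ w ℕ.* 1)           ≡⟨ ≡.cong (λ d → n ℤ.* + d) (ℕ.*-identityʳ (↧ₙ w)) ⟩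
  n ℤ.* ↧ w                      ∎
  where open ≡.≡-Reasoning

*↧≡↥ : ∀ q → q ℚ.* fromℤ (↧ q) ≡ fromℤ (↥ q)
*↧≡↥ q@record{} = ℚ.toℚᵘ-injective (begin
  toℚᵘ (q ℚ.* fromℤ (↧ q))         ≈⟨ ℚ.toℚᵘ-homo-* q (fromℤ (↧ q)) ⟩
  toℚᵘ q ℚᵘ.* toℚᵘ (fromℤ (↧ q))   ≈⟨ ℚᵘ.*-congˡ {toℚᵘ q} (toℚᵘ-fromℤ (↧ q)) ⟩
  toℚᵘ q ℚᵘ.* mkℚᵘ (↧ q) 0         ≈⟨ *≡* (≡.trans (ℤ.*-identityʳ _) (≡.cong (λ d → ↥ q ℤ.* + d) (≡.sym (ℕ.*-identityʳ (↧ₙ q))))) ⟩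
  mkℚᵘ (↥ q) 0                     ≈⟨ toℚᵘ-fromℤ (↥ q) ⟨
  toℚᵘ (fromℤ (↥ q))               ∎)
  where open ℚᵘ.≃-Reasoning

-- Approximation in the p-adic norm

module _ {p} (p-prime : Prime p) where

  private instance
    p≢0 : NonZero p
    p≢0 = prime⇒nonZero p-prime

  -- By Euclid's lemma each factor p of the product can be taken from `u` or from `d`, and `d`
  -- supplies at most `e` of them.
  ^-cancel-∣ : ∀ k e u d → p ^ (k ℕ.+ e) ℕ.∣ u ℕ.* d → ¬ p ^ suc e ℕ.∣ d → p ^ k ℕ.∣ u
  ^-cancel-∣ zero    e u d _ _ = ℕ.1∣ u
  ^-cancel-∣ (suc k) e u d pᵏ⁺ᵉ∣ud pᵉ∤d
    with euclidsLemma u d p-prime (ℕ.∣-trans (ℕ.m∣m*n (p ^ (k ℕ.+ e))) pᵏ⁺ᵉ∣ud)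
  ... | inj₁ (ℕ.divides v ≡.refl) = ≡.subst (p ^ suc k ℕ.∣_) (ℕ.*-comm p v)
    (ℕ.*-monoʳ-∣ p (^-cancel-∣ k e v d (ℕ.*-cancelˡ-∣ p (≡.subst (p ^ (suc k ℕ.+ e) ℕ.∣_)
      (≡.trans (≡.cong (ℕ._* d) (ℕ.*-comm v p)) (ℕ.*-assoc p v d)) pᵏ⁺ᵉ∣ud)) pᵉ∤d))
  ^-cancel-∣ (suc k) zero    u d _ p∤d | inj₂ p∣d =
    contradiction (≡.subst (ℕ._∣ d) (≡.sym (ℕ.*-identityʳ p)) p∣d) p∤d
  ^-cancel-∣ (suc k) (suc e) u d pᵏ⁺ᵉ∣ud pᵉ∤d | inj₂ (ℕ.divides c ≡.refl) =
    ^-cancel-∣ (suc k) e u c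
      (ℕ.*-cancelˡ-∣ p (≡.subst₂ ℕ._∣_ (≡.cong (λ i → p ^ suc i) (ℕ.+-suc k e))
        (≡.trans (≡.sym (ℕ.*-assoc u c p)) (ℕ.*-comm (u ℕ.* c) p)) pᵏ⁺ᵉ∣ud))
      λ pᵉ∣c → pᵉ∤d (≡.subst (p ^ suc (suc e) ℕ.∣_) (ℕ.*-comm p c) (ℕ.*-monoʳ-∣ p pᵉ∣c))

  -- Here `e` bounds the valuation of the denominator `a`. The exponent `suc k` is positive, so p
  -- divides the reduced numerator and coprimality keeps it out of the reduced denominator.
  normBound-from-fraction : ∀ k e w a n → w ℚ.* fromℤ a ≡ fromℤ n →
    + (p ^ (suc k ℕ.+ e)) ∣ n → ¬ p ^ suc e ℕ.∣ ∣ a ∣ → NormBound p (suc k) w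
  normBound-from-fraction k e w@(mkℚ _ _ coprime) a n eq pᵏ⁺ᵉ∣n pᵉ∤a = pᵏ∣↥w , λ p∣↧w →
    ¬prime[1] (≡.subst Prime (Coprime.recompute coprime (ℕ.∣-trans (ℕ.m∣m*n (p ^ k)) pᵏ∣↥w , p∣↧w)) p-prime)
    where
    pᵏ∣↥w : p ^ suc k ℕ.∣ ∣ ↥ w ∣
    pᵏ∣↥w = ^-cancel-∣ (suc k) e ∣ ↥ w ∣ ∣ a ∣
      (≡.subst (p ^ (suc k ℕ.+ e) ℕ.∣_)
        (≡.trans (≡.cong ∣_∣ (≡.sym (↥*≡*↧ {w} {a} {n} eq))) (ℤ.abs-* (↥ w) a))
        (∣⇒∣ᵤ (∣m⇒∣m*n (↧ w) pᵏ⁺ᵉ∣n))) pᵉ∤a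

  -- The ultrametric inequality: the common denominator is prime to p by Euclid's lemma, so the
  -- previous lemma applies with e = 0.
  normBound-+ : ∀ k u v → NormBound p (suc k) u → NormBound p (suc k) v → NormBound p (suc k) (u ℚ.+ v)
  normBound-+ k u v (pᵏ∣↥u , p∤↧u) (pᵏ∣↥v , p∤↧v) =
    normBound-from-fraction k 0 (u ℚ.+ v) (↧ u ℤ.* ↧ v) (↥ u ℤ.* ↧ v ℤ.+ ↥ v ℤ.* ↧ u) (begin
      (u ℚ.+ v) ℚ.* fromℤ (↧ u ℤ.* ↧ v)
        ≡⟨ ≡.cong ((u ℚ.+ v) ℚ.*_) (fromℤ-* (↧ u) (↧ v)) ⟩
      (u ℚ.+ v) ℚ.* (fromℤ (↧ u) ℚ.* fromℤ (↧ v))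
        ≡⟨ solve 4 (λ u v c d → (u :+ v) :* (c :* d) := (u :* c) :* d :+ (v :* d) :* c) ≡.refl
             u v (fromℤ (↧ u)) (fromℤ (↧ v)) ⟩
      u ℚ.* fromℤ (↧ u) ℚ.* fromℤ (↧ v) ℚ.+ v ℚ.* fromℤ (↧ v) ℚ.* fromℤ (↧ u)
        ≡⟨ ≡.cong₂ (λ a b → a ℚ.* fromℤ (↧ v) ℚ.+ b ℚ.* fromℤ (↧ u)) (*↧≡↥ u) (*↧≡↥ v) ⟩
      fromℤ (↥ u) ℚ.* fromℤ (↧ v) ℚ.+ fromℤ (↥ v) ℚ.* fromℤ (↧ u)
        ≡⟨ ≡.cong₂ ℚ._+_ (fromℤ-* (↥ u) (↧ v)) (fromℤ-* (↥ v) (↧ u)) ⟨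
      fromℤ (↥ u ℤ.* ↧ v) ℚ.+ fromℤ (↥ v ℤ.* ↧ u)
        ≡⟨ fromℤ-+ (↥ u ℤ.* ↧ v) (↥ v ℤ.* ↧ u) ⟨
      fromℤ (↥ u ℤ.* ↧ v ℤ.+ ↥ v ℤ.* ↧ u) ∎)
      (≡.subst (λ i → + (p ^ i) ∣ ↥ u ℤ.* ↧ v ℤ.+ ↥ v ℤ.* ↧ u) (≡.sym (ℕ.+-identityʳ (suc k)))
        (∣m∣n⇒∣m+n (∣m⇒∣m*n {m = ↥ u} (↧ v) (∣ᵤ⇒∣ pᵏ∣↥u)) (∣m⇒∣m*n {m = ↥ v} (↧ u) (∣ᵤ⇒∣ pᵏ∣↥v))))
      λ p∣↧u↧v → Sum.[ p∤↧u , p∤↧v ]′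
        (euclidsLemma (↧ₙ u) (↧ₙ v) p-prime (≡.subst₂ ℕ._∣_ (ℕ.*-identityʳ p) (ℤ.abs-* (↧ u) (↧ v)) p∣↧u↧v))
    where
    open ≡.≡-Reasoning
    open ℚ.+-*-Solver

  n<p^n : ∀ n → n < p ^ n
  n<p^n zero    = z<s
  n<p^n (suc n) = begin-strict
    suc n              ≤⟨ n<p^n n ⟩
    p ^ n              <⟨ ℕ.m<m+n (p ^ n) (ℕ.≤-<-trans z≤n (n<p^n n)) ⟩
    p ^ n ℕ.+ p ^ n    ≡⟨ ≡.cong (p ^ n ℕ.+_) (ℕ.+-identityʳ (p ^ n)) ⟨
    2 ℕ.* p ^ n        ≤⟨ ℕ.*-monoˡ-≤ (p ^ n) (ℕ.nonTrivial⇒n>1 p {{prime⇒nonTrivial p-prime}}) ⟩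
    p ℕ.* p ^ n        ∎
    where open ℕ.≤-Reasoning

  ∣-weaken-^ : ∀ {m n i} → m ≤ n → + (p ^ n) ∣ i → + (p ^ m) ∣ i
  ∣-weaken-^ {m} {n} m≤n = ∣-trans (∣ᵤ⇒∣ (≡.subst (λ i → p ^ m ℕ.∣ p ^ i) (ℕ.m+[n∸m]≡n m≤n)
    (≡.subst (p ^ m ℕ.∣_) (≡.sym (ℕ.^-distribˡ-+-* p m _)) (ℕ.m∣m*n _))))

  -- Write q = a / b, and choose f(y) ≡ p b and f(x) ≡ p a modulo a high power
  -- of p, so that f(x) / f(y) approximates q.
  ratio-approximates : (f : ℤ → ℤ) →
    (∀ z → + p ∣ z → ∀ k → ∃[ x ] + (p ^ suc k) ∣ f x ℤ.- z) →
    ∀ q k → ∃₂ λ x y → f y ≢ 0ℤ ×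
      ∃[ r ] r ℚ.* fromℤ (f y) ≡ fromℤ (f x) × NormBound p (suc k) (q ℚ.- r)
  ratio-approximates f approx q k = x , y , Y≢0 , r , rY≡X ,
    normBound-from-fraction k (b ℕ.+ b) (q ℚ.- r) (Y ℤ.* + b) n [q-r]Yb≡n pᴹ∣n p∤Yb
    where
    b = ↧ₙ q
    a = ↥ q
    -- The difference q - r has denominator Y b. The valuations of `Y` and `b` are each at most b,
    -- so 2b extra factors of p in the numerator absorb it.
    M = k ℕ.+ (b ℕ.+ b)
    y-approx = approx (+ p ℤ.* + b) (∣m⇒∣m*n (+ b) ∣-refl) M
    x-approx = approx (+ p ℤ.* a) (∣m⇒∣m*n a ∣-refl) M
    y = proj₁ y-approx
    x = proj₁ x-approx
    Y = f y
    X = f x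

    pᵇ∤b : ¬ p ^ b ℕ.∣ b
    pᵇ∤b pᵇ∣b = ℕ.<⇒≱ (n<p^n b) (ℕ.∣⇒≤ pᵇ∣b)

    p¹⁺ᵇ∤Y : ¬ + (p ^ suc b) ∣ Y
    -- Since Y ≡ p b modulo p^(1+M) and b ≤ M, divisibility of `Y` would pass to p b, giving p^b ∣
    -- b.
    p¹⁺ᵇ∤Y p¹⁺ᵇ∣Y = pᵇ∤b (ℕ.*-cancelˡ-∣ p (∣⇒∣ᵤ (≡.subst (+ (p ^ suc b) ∣_)
      (≡.trans (lemma Y (+ p ℤ.* + b)) (≡.sym (ℤ.pos-* p b)))
      (∣m∣n⇒∣m-n p¹⁺ᵇ∣Y (∣-weaken-^ (s≤s (ℕ.≤-trans (ℕ.m≤m+n b b) (ℕ.m≤n+m _ k))) (proj₂ y-approx))))))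
      where
      lemma : ∀ y z → y ℤ.- (y ℤ.- z) ≡ z
      lemma = solve-∀

    Y≢0 : Y ≢ 0ℤ
    Y≢0 Y≡0 = p¹⁺ᵇ∤Y (≡.subst (+ (p ^ suc b) ∣_) (≡.sym Y≡0) (∣ᵤ⇒∣ ((p ^ suc b) ℕ.∣0)))

    p∤Yb : ¬ p ^ suc (b ℕ.+ b) ℕ.∣ ∣ Y ℤ.* + b ∣
    p∤Yb p∣Yb = p¹⁺ᵇ∤Y (∣ᵤ⇒∣ (^-cancel-∣ (suc b) b ∣ Y ∣ b
      (≡.subst (p ^ suc (b ℕ.+ b) ℕ.∣_) (ℤ.abs-* Y (+ b)) p∣Yb)
      λ p¹⁺ᵇ∣b → pᵇ∤b (ℕ.∣-trans (ℕ.n∣m*n p) p¹⁺ᵇ∣b)))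

    Y⁻¹ = proj₁ (fromℤ-invertible Y≢0)
    r = fromℤ X ℚ.* Y⁻¹

    rY≡X : r ℚ.* fromℤ Y ≡ fromℤ X
    rY≡X = ≡.trans (ℚ.*-assoc (fromℤ X) Y⁻¹ (fromℤ Y))
      (≡.trans (≡.cong (fromℤ X ℚ.*_) (proj₂ (fromℤ-invertible Y≢0))) (ℚ.*-identityʳ (fromℤ X)))

    n = a ℤ.* Y ℤ.+ ℤ.- (X ℤ.* + b)

    [q-r]Yb≡n : (q ℚ.- r) ℚ.* fromℤ (Y ℤ.* + b) ≡ fromℤ n
    [q-r]Yb≡n = begin
      (q ℚ.- r) ℚ.* fromℤ (Y ℤ.* + b)
        ≡⟨ ≡.cong ((q ℚ.- r) ℚ.*_) (fromℤ-* Y (+ b)) ⟩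
      (q ℚ.- r) ℚ.* (fromℤ Y ℚ.* fromℤ (+ b))
        ≡⟨ solve 4 (λ q r Y b → (q :- r) :* (Y :* b) := (q :* b) :* Y :- (r :* Y) :* b) ≡.refl
             q r (fromℤ Y) (fromℤ (+ b)) ⟩
      q ℚ.* fromℤ (+ b) ℚ.* fromℤ Y ℚ.- r ℚ.* fromℤ Y ℚ.* fromℤ (+ b)
        ≡⟨ ≡.cong₂ (λ s t → s ℚ.* fromℤ Y ℚ.- t ℚ.* fromℤ (+ b)) (*↧≡↥ q) rY≡X ⟩
      fromℤ a ℚ.* fromℤ Y ℚ.- fromℤ X ℚ.* fromℤ (+ b)
        ≡⟨ ≡.cong₂ ℚ._-_ (fromℤ-* a Y) (fromℤ-* X (+ b)) ⟨
      fromℤ (a ℤ.* Y) ℚ.- fromℤ (X ℤ.* + b)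
        ≡⟨ ≡.cong (fromℤ (a ℤ.* Y) ℚ.+_) (fromℤ-neg (X ℤ.* + b)) ⟨
      fromℤ (a ℤ.* Y) ℚ.+ fromℤ (ℤ.- (X ℤ.* + b))
        ≡⟨ fromℤ-+ (a ℤ.* Y) (ℤ.- (X ℤ.* + b)) ⟨
      fromℤ n ∎
      where
      open ≡.≡-Reasoning
      open ℚ.+-*-Solver

    pᴹ∣n : + (p ^ suc M) ∣ n
    -- In a (Y - p b) - (X - p a) b the terms p a b cancel, leaving the numerator of q - r.
    pᴹ∣n = ≡.subst (+ (p ^ suc M) ∣_) (lemma a Y X (+ b) (+ p))
      (∣m∣n⇒∣m-n (∣n⇒∣m*n a (proj₂ y-approx)) (∣m⇒∣m*n (+ b) (proj₂ x-approx)))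
      where
      lemma : ∀ a Y X b p → a ℤ.* (Y ℤ.- p ℤ.* b) ℤ.- (X ℤ.- p ℤ.* a) ℤ.* b ≡ a ℤ.* Y ℤ.+ ℤ.- (X ℤ.* b)
      lemma = solve-∀

  -- A late term of the Cauchy sequence stands in for its limit, and the ultrametric inequality
  -- carries its approximation over to all later terms. Working at `suc k` and weakening at the end
  -- covers k = 0.
  dense-in-ℚ⇒dense-in-ℚₚ : ∀ {ℓ} {S : ℚ → Set ℓ} →
    (∀ q k → ∃[ r ] S r × NormBound p (suc k) (q ℚ.- r)) →
    ∀ (α : Padic p) k → ∃[ r ] S r × WithinBall α k r
  dense-in-ℚ⇒dense-in-ℚₚ dense α k =
    let N , close = cauchy (suc k)
        r , Sr , q-r-small = dense (seq N) k
    in r , Sr , N , λ i N≤i →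
      let pᵏ⁺¹∣ , p∤ = normBound-+ k (seq i ℚ.- seq N) (seq N ℚ.- r) (close i N N≤i ℕ.≤-refl) q-r-small
      in ≡.subst (NormBound p k) (telescope (seq i) (seq N) r) (ℕ.∣-trans (ℕ.n∣m*n p) pᵏ⁺¹∣ , p∤)
    where
    open Padic α
    open ℚ.+-*-Solver
    telescope : ∀ u v w → (u ℚ.- v) ℚ.+ (v ℚ.- w) ≡ u ℚ.- w
    telescope = solve 3 (λ u v w → (u :- v) :+ (v :- w) := u :- w) ≡.refl

-- Restricting the form to a line

evaluate-term : ∀ c e x → evaluate (term c e) x ≡ c ℤ.* x ℤ.^ e
evaluate-term c zero    x = ≡.trans (≡.cong (λ y → c ℤ.+ y) (ℤ.*-zeroʳ x))
  (≡.trans (ℤ.+-identityʳ c) (≡.sym (ℤ.*-identityʳ c)))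
evaluate-term c (suc e) x = ≡.trans (ℤ.+-identityˡ _)
  (≡.trans (≡.cong (x ℤ.*_) (evaluate-term c e x)) (lemma x c (x ℤ.^ e)))
  where
  lemma : ∀ x c y → x ℤ.* (c ℤ.* y) ≡ c ℤ.* (x ℤ.* y)
  lemma = solve-∀

evaluate-+ₚ : ∀ f g x → evaluate (f +ₚ g) x ≡ evaluate f x ℤ.+ evaluate g x
evaluate-+ₚ f g x = begin
  evaluate (f +ₚ g) x                                            ≡⟨ ≡.cong (λ h → evaluate h x) (map-id (f +ₚ g)) ⟨
  IdEvaluation.⟦ f +ₚ g ⟧ x                                      ≡⟨ IdEvaluation.⟦⟧-+ₚ f g x ⟩
  IdEvaluation.⟦ f ⟧ x ℤ.+ IdEvaluation.⟦ g ⟧ x                  ≡⟨ ≡.cong₂ (λ h k → evaluate h x ℤ.+ evaluate k x) (map-id f) (map-id g) ⟩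
  evaluate f x ℤ.+ evaluate g x                                  ∎
  where open ≡.≡-Reasoning

eval-specialise : ∀ {n} (F : Polynomial (suc n)) a x → eval F (x ∷ a) ≡ evaluate (specialise F a) x
eval-specialise []                 a x = ≡.refl
eval-specialise ((c , e ∷ es) ∷ F) a x = begin
  c ℤ.* (x ℤ.^ e ℤ.* monomial a es) ℤ.+ eval F (x ∷ a)
    ≡⟨ ≡.cong₂ ℤ._+_ (lemma c (x ℤ.^ e) (monomial a es)) (eval-specialise F a x) ⟩
  c ℤ.* monomial a es ℤ.* x ℤ.^ e ℤ.+ evaluate (specialise F a) x
    ≡⟨ ≡.cong (ℤ._+ _) (evaluate-term (c ℤ.* monomial a es) e x) ⟨
  evaluate (term (c ℤ.* monomial a es) e) x ℤ.+ evaluate (specialise F a) x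
    ≡⟨ evaluate-+ₚ (term (c ℤ.* monomial a es) e) (specialise F a) x ⟨
  evaluate (term (c ℤ.* monomial a es) e +ₚ specialise F a) x ∎
  where
  open ≡.≡-Reasoning
  lemma : ∀ c y m → c ℤ.* (y ℤ.* m) ≡ c ℤ.* m ℤ.* y
  lemma = solve-∀

-- Simple roots modulo large primes, and the theorem

module _ {c ℓ₁ ℓ₂} (K : AlgebraicClosureOfℚ c ℓ₁ ℓ₂) where
  open AlgebraicClosureOfℚ K
    hiding (evaluate; coeff; _≈ₚ_; _+ₚ_; _*ₚ_; term; zero)
  open HeytingFieldProperties field′
  open SimpleRoots field′ using (discriminant#0⇒simple)

  private
    φ : ℤ → Carrier
    φ z = ι (fromℤ z)

    φ-homomorphic : IsRingHomomorphism ℤ.+-*-rawRing (CommutativeRing.rawRing commutativeRing) φ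
    φ-homomorphic = Composition.isRingHomomorphism trans fromℤ-isRingHomomorphism ι-homomorphic

  open IsRingHomomorphism ι-homomorphic using (*-homo; 1#-homo; 0#-homo)

  -- A non-zero integer has an inverse in ℚ, which `ι` carries to an inverse in the field.
  φ#0 : ∀ {a} → a ≢ 0ℤ → φ a # 0#
  φ#0 {a} a≢0 = let r , ra≡1 = fromℤ-invertible a≢0 in
    x*y#0⇒y#0 {ι r} (#-congʳ
      (trans (sym 1#-homo) (trans (reflexive (≡.cong ι (≡.sym ra≡1))) (*-homo r (fromℤ a)))) 1#0)

  open Evaluation ℤ.+-*-commutativeRing commutativeRing φ-homomorphic
  open CommonRoots field′ closed φ-homomorphic φ#0

  coprime-derivative : ∀ {f} → HasNonZeroDiscriminant K f → Coprimeₚ f (derivative f)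
  coprime-derivative {f} (D , isDiscriminant , D#0) = Sum.[
    (λ (x , fx≈0 , f′x≈0) → ⊥-elim (discriminant#0⇒simple isDiscriminant D#0 x fx≈0
      (trans (sym (⟦⟧-derivative f x)) f′x≈0))) ,
    (λ coprime → coprime) ]′ (dichotomy f (derivative f))

  nonconstant : ∀ {f} → HasNonZeroDiscriminant K f → ¬ List.drop 1 f ≈ₚ []
  nonconstant {f} (D , isDiscriminant , _) f≈c = ≈⇒¬# (f-coeff≈0 f f≈c m m≥1) (proj₁ degree)
    where
    open OverField.IsDiscriminant isDiscriminant
    f-coeff≈0 : ∀ f → List.drop 1 f ≈ₚ [] → ∀ i → 1 ≤ i → OverField.coeff field′ (List.map φ f) i ≈ 0#
    f-coeff≈0 []      _   _       _ = refl
    f-coeff≈0 (_ ∷ f) f≈0 (suc i) _ = trans (coeff-map f i) (trans (reflexive (≡.cong φ (f≈0 i))) 0#-homo)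

  simple-root-mod-large-prime : ∀ {f} → HasNonZeroDiscriminant K f → ∀ N →
    ∃₂ λ p x → N < p × Prime p × (+ p ∣ evaluate f x) × ¬ (+ p ∣ slope f x)
  simple-root-mod-large-prime {f} disc N =
    let Δ , Δ≢0 , dvd = coprime-derivative disc
        -- A prime larger than ∣Δ∣ cannot divide the non-zero integer Δ, hence cannot divide both
        -- f(x) and f′(x).
        p , x , N+Δ<p , p-prime , p∣fx = value-with-large-prime-divisor f (nonconstant disc) (N ℕ.+ ∣ Δ ∣)
        instance
          ∣Δ∣≢0 : NonZero ∣ Δ ∣
          ∣Δ∣≢0 = ℕ.≢-nonZero λ ∣Δ∣≡0 → Δ≢0 (ℤ.∣i∣≡0⇒i≡0 ∣Δ∣≡0)
    in p , x , ℕ.≤-<-trans (ℕ.m≤m+n N ∣ Δ ∣) N+Δ<p , p-prime , p∣fx , λ p∣f′x →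
      ℕ.<⇒≱ (ℕ.≤-<-trans (ℕ.m≤n+m ∣ Δ ∣ N) N+Δ<p) (ℕ.∣⇒≤ (∣⇒∣ᵤ (dvd x (+ p)
        (≡.subst (λ g → + p ∣ evaluate g x) (≡.sym (map-id f)) p∣fx)
        (≡.subst (+ p ∣_) (≡.sym (≡.trans (IdEvaluation.⟦⟧-derivative f x) (≡.cong (λ g → slope g x) (map-id f)))) p∣f′x))))

theorem1p1 : ∀ {c ℓ₁ ℓ₂} (K : AlgebraicClosureOfℚ c ℓ₁ ℓ₂)
    (n-1 d : ℕ) (F : Polynomial (suc n-1)) →
    IsHomogeneous d F →
    1 < d →
    (∃[ a ] HasNonZeroDiscriminant K (specialise F a)) →
    ∀ N → ∃[ p ] N < p × Prime p × DenseInℚₚ p (RatioSet F)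
theorem1p1 K n-1 d F _ _ (a , disc) N =
  let p , x₀ , N<p , p-prime , p∣fx₀ , p∤f′x₀ = simple-root-mod-large-prime K disc N
      f = specialise F a
      dense : ∀ q k → ∃[ r ] RatioSet F r × NormBound p (suc k) (q ℚ.- r)
      dense q k =
        let x , y , fy≢0 , r , r*fy≡fx , bound = ratio-approximates p-prime (evaluate f)
              (λ z p∣z j → let x , eq , _ = hensel p-prime f p∣fx₀ p∤f′x₀ p∣z j in x , eq) q k
        -- Both points lie on the line with last coordinates `a`, so the ratio of values of f is a
        -- ratio of values of `F`.
        in r , (x ∷ a , y ∷ a ,
             (λ Fy≡0 → fy≢0 (≡.trans (≡.sym (eval-specialise F a y)) Fy≡0)) ,
             ≡.subst₂ (λ Y X → r ℚ.* fromℤ Y ≡ fromℤ X)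
               (≡.sym (eval-specialise F a y)) (≡.sym (eval-specialise F a x)) r*fy≡fx) ,
           bound
  in p , N<p , p-prime , dense-in-ℚ⇒dense-in-ℚₚ p-prime {S = RatioSet F} dense
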